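{- Let $D_1$ and $D_2$ be simple digraphs on $n_1$ and $n_2$ vertices, with $D_1$ having $m_1$ arcs, and let $G_1=U(D_1)$ be the underlying graph of $D_1$, with $m_1'$ edges. Then (i) $\displaystyle f_{L(D_1 \overrightarrow{\diamond} D_2)} (\lambda)= \big[f_{L(D_2)}(\lambda-1)\big]^{m_1} \det\left(\lambda I_{n_1}-\big(L(D_1)+n_2D_{\rm out}(D_1)\big)-\frac{n_2}{\lambda-1}\,A(D_1)\right)$, (ii) $\displaystyle f_{L(D_1 \overleftarrow{\diamond} D_2)}(\lambda)= \big[f_{L(D_2)}(\lambda-1)\big]^{m_1} \det\left(\lambda I_{n_1}-\big(L(D_1)+n_2D_{\rm in}(D_1)\big)-\frac{n_2}{\lambda-1}\,A(D_1)^T\right)$, (iii) $\displaystyle f_{L(D_1 \overleftrightarrow{\diamond} D_2)}(\lambda)= \big[f_{L(D_2)}(\lambda-2)\big]^{m_1'}\det\left(\lambda I_{n_1}-\big(L(D_1)+n_2D_{\rm deg}(G_1)\big)-\frac{n_2}{\lambda-2}\,Q(G_1)\right)$.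
   Context: Digraphs are simple. $A(D)$ is the adjacency matrix, $D_{\rm out}(D)$ and $D_{\rm in}(D)$ the diagonal out-degree and in-degree matrices, $L(D)=D_{\rm out}(D)-A(D)$. The underlying graph $U(D)$ has an edge $\{u,v\}$ whenever $uv$ or $vu$ is an arc; for a graph $G$, $D_{\rm deg}(G)$ is the diagonal degree matrix and $Q(G)=D_{\rm deg}(G)+A(G)$. $f_M(\lambda)=\det(\lambda I-M)$. Forward-arc-corona $D_1 \overrightarrow{\diamond} D_2$: one copy of $D_1$ and $m_1$ disjoint copies of $D_2$, one per arc; for each arc $a_k=uv$ and each vertex $w$ of the $k$-th copy of $D_2$ add arcs $uw$ and $wv$. Backward-arc-corona $D_1 \overleftarrow{\diamond} D_2$: same, but add arcs $vw$ and $wu$. Symmetric-arc-corona $D_1 \overleftrightarrow{\diamond} D_2$: one copy of $D_1$ and one copy of $D_2$ per edge of $U(D_1)$; for each edge $\{u,v\}$ and each vertex $w$ of the corresponding copy add arcs $uw,wu,vw,wv$. -}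

module Defs where

open import Data.Nat as ℕ using (ℕ; zero; suc)
open import Data.Bool using (Bool; true; false; if_then_else_; _∧_; _∨_)
open import Data.Fin as Fin using (Fin; zero; suc; splitAt; remQuot; punchIn; toℕ)
open import Data.Fin.Properties using (_≟_)
open import Data.Sum using (_⊎_; inj₁; inj₂)
open import Data.Product using (_×_; _,_; proj₁; proj₂)
open import Data.List as List using (List; length; filterᵇ; cartesianProduct; allFin; lookup)
open import Data.Integer using (+_)
open import Data.Rational as ℚ using (ℚ; 0ℚ; 1ℚ; _+_; _*_; -_; _-_)
open import Relation.Nullary.Decidable using (⌊_⌋)
open import Relation.Binary.PropositionalEquality using (_≡_)

Mat : ℕ → Set
Mat n = Fin n → Fin n → ℚ

fromℕ : ℕ → ℚ
fromℕ k = (+ k) ℚ./ 1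

⟦_⟧ : Bool → ℚ
⟦ true ⟧  = 1ℚ
⟦ false ⟧ = 0ℚ

∑ : ∀ {n} → (Fin n → ℚ) → ℚ
∑ {zero}  f = 0ℚ
∑ {suc n} f = f zero + ∑ (λ i → f (suc i))

sign : ℕ → ℚ
sign zero    = 1ℚ
sign (suc k) = - sign k

_^_ : ℚ → ℕ → ℚ
p ^ zero  = 1ℚ
p ^ suc k = p * (p ^ k)

det : ∀ {n} → Mat n → ℚ
det {zero}  M = 1ℚ
det {suc n} M =
  ∑ (λ j → sign (toℕ j) * (M zero j * det (λ r c → M (suc r) (punchIn j c))))

I : ∀ {n} → Mat n
I i j = if ⌊ i ≟ j ⌋ then 1ℚ else 0ℚ

_·_ : ∀ {n} → ℚ → Mat n → Mat n
(c · M) i j = c * M i j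

_⊕_ : ∀ {n} → Mat n → Mat n → Mat n
(M ⊕ N) i j = M i j + N i j

_⊖_ : ∀ {n} → Mat n → Mat n → Mat n
(M ⊖ N) i j = M i j - N i j

_ᵀ : ∀ {n} → Mat n → Mat n
(M ᵀ) i j = M j i

diag : ∀ {n} → (Fin n → ℚ) → Mat n
diag d i j = if ⌊ i ≟ j ⌋ then d i else 0ℚ

charPoly : ∀ {n} → Mat n → ℚ → ℚ
charPoly M x = det ((x · I) ⊖ M)

-- arc relation on vertex set Fin n (no multiple arcs by construction)
Adj : ℕ → Set
Adj n = Fin n → Fin n → Bool

record Digraph (n : ℕ) : Set where
  field
    adj    : Adj n
    irrefl : ∀ i → adj i i ≡ false
open Digraph public

AMat : ∀ {n} → Adj n → Mat n
AMat a i j = ⟦ a i j ⟧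

outdeg : ∀ {n} → Adj n → Fin n → ℚ
outdeg a i = ∑ (λ j → ⟦ a i j ⟧)

indeg : ∀ {n} → Adj n → Fin n → ℚ
indeg a j = ∑ (λ i → ⟦ a i j ⟧)

Dout : ∀ {n} → Adj n → Mat n
Dout a = diag (outdeg a)

Din : ∀ {n} → Adj n → Mat n
Din a = diag (indeg a)

Lap : ∀ {n} → Adj n → Mat n
Lap a = Dout a ⊖ AMat a

U : ∀ {n} → Adj n → Adj n
U a i j = a i j ∨ a j i

-- for a graph G (symmetric adjacency): degree matrix and signless Laplacian
Ddeg : ∀ {n} → Adj n → Mat n
Ddeg g = diag (outdeg g)

Q : ∀ {n} → Adj n → Mat n
Q g = Ddeg g ⊕ AMat g

-- the arcs of D, listed in lexicographic order: a_0, …, a_{m-1}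
arcs : ∀ {n} → Adj n → List (Fin n × Fin n)
arcs {n} a = filterᵇ (λ p → a (proj₁ p) (proj₂ p)) (cartesianProduct (allFin n) (allFin n))

-- the edges {u,v} (stored as (u,v) with u < v) of U(D), lexicographic order
edges : ∀ {n} → Adj n → List (Fin n × Fin n)
edges {n} a =
  filterᵇ (λ p → ⌊ toℕ (proj₁ p) ℕ.<? toℕ (proj₂ p) ⌋ ∧ U a (proj₁ p) (proj₂ p))
          (cartesianProduct (allFin n) (allFin n))

_==_ : ∀ {n} → Fin n → Fin n → Bool
i == j = ⌊ i ≟ j ⌋

-- Arc coronas.  Vertex set Fin (n₁ + m * n₂): the first n₁ vertices are
-- the copy of D₁, vertex (k , w) (via remQuot) is vertex w of the k-th
-- copy of D₂ (attached to the k-th arc / edge).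

-- generic construction: copies indexed by a list es of vertex pairs,
-- `into u e` says whether there is an arc from u (in D₁) to the copy of e,
-- `outof e v` whether there is an arc from the copy of e to v (in D₁)
corona : ∀ {n₁ n₂} → Adj n₁ → Adj n₂ → (es : List (Fin n₁ × Fin n₁)) →
         (Fin n₁ → Fin n₁ × Fin n₁ → Bool) → (Fin n₁ × Fin n₁ → Fin n₁ → Bool) →
         Adj (n₁ ℕ.+ length es ℕ.* n₂)
corona {n₁} {n₂} a₁ a₂ es into outof x y with splitAt n₁ x | splitAt n₁ y
... | inj₁ u | inj₁ v = a₁ u v
... | inj₁ u | inj₂ q = into u (lookup es (proj₁ (remQuot n₂ q)))
... | inj₂ p | inj₁ v = outof (lookup es (proj₁ (remQuot n₂ p))) v
... | inj₂ p | inj₂ q with remQuot {length es} n₂ p | remQuot {length es} n₂ q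
...   | (k , w) | (k′ , w′) = (k == k′) ∧ a₂ w w′

-- forward-arc-corona: for arc uv and w in its copy, arcs uw and wv
fwdCorona : ∀ {n₁ n₂} (D₁ : Digraph n₁) → Digraph n₂ → Adj (n₁ ℕ.+ length (arcs (adj D₁)) ℕ.* n₂)
fwdCorona D₁ D₂ = corona (adj D₁) (adj D₂) (arcs (adj D₁))
  (λ u e → u == proj₁ e) (λ e v → v == proj₂ e)

-- backward-arc-corona: for arc uv and w in its copy, arcs vw and wu
bwdCorona : ∀ {n₁ n₂} (D₁ : Digraph n₁) → Digraph n₂ → Adj (n₁ ℕ.+ length (arcs (adj D₁)) ℕ.* n₂)
bwdCorona D₁ D₂ = corona (adj D₁) (adj D₂) (arcs (adj D₁))
  (λ v e → v == proj₂ e) (λ e u → u == proj₁ e)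

-- symmetric-arc-corona: for edge {u,v} of U(D₁) and w in its copy,
-- arcs uw, wu, vw, wv
symCorona : ∀ {n₁ n₂} (D₁ : Digraph n₁) → Digraph n₂ → Adj (n₁ ℕ.+ length (edges (adj D₁)) ℕ.* n₂)
symCorona D₁ D₂ = corona (adj D₁) (adj D₂) (edges (adj D₁))
  (λ u e → (u == proj₁ e) ∨ (u == proj₂ e)) (λ e v → (v == proj₁ e) ∨ (v == proj₂ e))

-- Order the vertices of the corona as those of D₁ followed by the m copies of D₂. On the copies,
-- λI − L is block diagonal with blocks (λ − δ)I − L(D₂), where δ (1 for the arc coronas, 2 for the
-- symmetric one) counts the arcs from a copy vertex back into D₁. The rows of (λ − δ)I − L(D₂) sum to
-- λ − δ, so subtracting suitable multiples 1/(λ − δ) of copy columns from the D₁ columns clears the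
-- copy rows there without changing the determinant. The result is block upper triangular: the copy
-- part contributes f_{L(D₂)}(λ − δ)^m, and the D₁ part is λI − L(D₁) corrected by n₂ times the number
-- of copies a vertex attaches to (the diagonal term) and by n₂/(λ − δ) times the number of copies
-- leading from u to v, which is A(D₁), A(D₁)ᵀ or Q(U(D₁)) respectively.

module Submission where

open import Defs
open import Data.Nat as ℕ using (ℕ; zero; suc)
import Data.Nat.Properties as ℕP
import Data.Fin.Properties as FinP
open import Data.Bool using (Bool; true; false; if_then_else_; _∧_; _∨_; not)
open import Data.Bool.Properties using (∨-comm)
open import Data.Fin
  using (Fin; zero; suc; toℕ; _↑ˡ_; _↑ʳ_; combine; remQuot; splitAt; punchIn; punchOut; inject₁; fromℕ<)
open import Data.Fin.Properties
  using ( _≟_; suc-injective; toℕ-injective; toℕ-inject₁; toℕ-↑ˡ; toℕ-fromℕ<; toℕ<n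
        ; punchIn-punchOut; punchInᵢ≢i; punchIn-injective
        ; splitAt-↑ˡ; splitAt-↑ʳ; ↑ˡ-injective; ↑ʳ-injective
        ; combine-remQuot; remQuot-combine; combine-injectiveˡ; combine-injectiveʳ )
open import Data.Integer as ℤ using ()
import Data.Integer.Properties as ℤP
import Data.Nat.Coprimality as Coprime
open import Data.Rational using (ℚ; 0ℚ; 1ℚ; _+_; _*_; -_; _-_; 1/_; NonZero)
open import Data.Rational.Properties hiding (_≟_)
open import Data.Rational.Solver
open +-*-Solver using (solve; _:+_; _:*_; _:-_; :-_; _:=_; con)
open import Data.List using (List; []; _∷_; length; lookup; filterᵇ; cartesianProduct; allFin; tabulate; map; _++_)
open import Data.Product using (Σ; _×_; _,_; proj₁; proj₂)
open import Data.Sum using (_⊎_; inj₁; inj₂)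
open import Data.Empty using (⊥-elim)
open import Function using (_∘_; id)
open import Relation.Nullary using (yes; no; Dec)
open import Relation.Nullary.Decidable using (⌊_⌋)
open import Relation.Binary.Definitions using (tri<; tri≈; tri>)
open import Relation.Binary.PropositionalEquality
open ≡-Reasoning

cong₃ : ∀ {A B C D : Set} (f : A → B → C → D) {a a′ b b′ c c′} → a ≡ a′ → b ≡ b′ → c ≡ c′ → f a b c ≡ f a′ b′ c′
cong₃ f refl refl refl = refl

∑-cong : ∀ {n} {f g : Fin n → ℚ} → (∀ i → f i ≡ g i) → ∑ f ≡ ∑ g
∑-cong {zero}  e = refl
∑-cong {suc n} e = cong₂ _+_ (e zero) (∑-cong (e ∘ suc))

∑-+ : ∀ {n} (f g : Fin n → ℚ) → ∑ (λ i → f i + g i) ≡ ∑ f + ∑ g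
∑-+ {zero}  f g = sym (+-identityˡ 0ℚ)
∑-+ {suc n} f g = begin
  (f zero + g zero) + ∑ (λ i → f (suc i) + g (suc i))
    ≡⟨ cong ((f zero + g zero) +_) (∑-+ (f ∘ suc) (g ∘ suc)) ⟩
  (f zero + g zero) + (∑ (f ∘ suc) + ∑ (g ∘ suc))
    ≡⟨ solve 4 (λ a b c d → (a :+ b) :+ (c :+ d) := (a :+ c) :+ (b :+ d)) refl (f zero) (g zero) _ _ ⟩
  (f zero + ∑ (f ∘ suc)) + (g zero + ∑ (g ∘ suc)) ∎

∑∑-+ : ∀ {m n} (f g : Fin m → Fin n → ℚ) →
       ∑ (λ i → ∑ (λ j → f i j + g i j)) ≡ ∑ (λ i → ∑ (f i)) + ∑ (λ i → ∑ (g i))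
∑∑-+ f g = trans (∑-cong (λ i → ∑-+ (f i) (g i))) (∑-+ (λ i → ∑ (f i)) (λ i → ∑ (g i)))

∑-*ˡ : ∀ {n} (c : ℚ) (f : Fin n → ℚ) → ∑ (λ i → c * f i) ≡ c * ∑ f
∑-*ˡ {zero}  c f = sym (*-zeroʳ c)
∑-*ˡ {suc n} c f = trans (cong (c * f zero +_) (∑-*ˡ c (f ∘ suc))) (sym (*-distribˡ-+ c _ _))

∑-*ʳ : ∀ {n} (c : ℚ) (f : Fin n → ℚ) → ∑ (λ i → f i * c) ≡ ∑ f * c
∑-*ʳ c f = trans (∑-cong (λ i → *-comm (f i) c)) (trans (∑-*ˡ c f) (*-comm c (∑ f)))

∑-zero : ∀ {n} (f : Fin n → ℚ) → (∀ i → f i ≡ 0ℚ) → ∑ f ≡ 0ℚ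
∑-zero {zero}  f e = refl
∑-zero {suc n} f e = trans (cong₂ _+_ (e zero) (∑-zero (f ∘ suc) (e ∘ suc))) (+-identityˡ 0ℚ)

∑-↑ : ∀ a {b} (f : Fin (a ℕ.+ b) → ℚ) → ∑ f ≡ ∑ (λ i → f (i ↑ˡ b)) + ∑ (λ j → f (a ↑ʳ j))
∑-↑ zero    f = sym (+-identityˡ _)
∑-↑ (suc a) f = trans (cong (f zero +_) (∑-↑ a (f ∘ suc))) (sym (+-assoc (f zero) _ _))

∑-combine : ∀ m {n} (f : Fin (m ℕ.* n) → ℚ) → ∑ f ≡ ∑ (λ k → ∑ (λ w → f (combine {m} {n} k w)))
∑-combine zero    f = refl
∑-combine (suc m) {n} f = trans (∑-↑ n f) (cong (∑ (λ w → f (w ↑ˡ (m ℕ.* n))) +_) (∑-combine m (λ j → f (n ↑ʳ j))))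

fromℕ-suc : ∀ n → fromℕ (suc n) ≡ 1ℚ + fromℕ n
fromℕ-suc n rewrite normalize-coprime (Coprime.sym (Coprime.1-coprimeTo n)) =
  sym (/-cong {p₂ = ℤ.+ suc n} {q₂ = 1} (cong (λ z → ℤ.+ 1 ℤ.+ z) (ℤP.*-identityʳ (ℤ.+ n))) refl)

∑-const : ∀ n (c : ℚ) → ∑ {n} (λ _ → c) ≡ fromℕ n * c
∑-const zero    c = sym (*-zeroˡ c)
∑-const (suc n) c = begin
  c + ∑ {n} (λ _ → c)  ≡⟨ cong (c +_) (∑-const n c) ⟩
  c + fromℕ n * c      ≡⟨ solve 2 (λ c f → c :+ f :* c := (con 1ℚ :+ f) :* c) refl c (fromℕ n) ⟩
  (1ℚ + fromℕ n) * c   ≡⟨ cong (_* c) (sym (fromℕ-suc n)) ⟩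
  fromℕ (suc n) * c    ∎

==-refl : ∀ {n} (i : Fin n) → (i == i) ≡ true
==-refl i with i ≟ i
... | yes _ = refl
... | no i≢i = ⊥-elim (i≢i refl)

≢⇒==false : ∀ {n} {i j : Fin n} → i ≢ j → (i == j) ≡ false
≢⇒==false {i = i} {j} i≢j with i ≟ j
... | yes i≡j = ⊥-elim (i≢j i≡j)
... | no _ = refl

==-sym : ∀ {n} (i j : Fin n) → (i == j) ≡ (j == i)
==-sym i j with i ≟ j
... | yes refl = sym (==-refl i)
... | no i≢j = sym (≢⇒==false (i≢j ∘ sym))

==-injective : ∀ {a b} (f : Fin a → Fin b) → (∀ {x y} → f x ≡ f y → x ≡ y) →
               ∀ x y → (f x == f y) ≡ (x == y)
==-injective f inj x y with x ≟ y
... | yes refl = ==-refl (f x)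
... | no x≢y = ≢⇒==false (x≢y ∘ inj)

⟦∧⟧ : ∀ b c → ⟦ b ∧ c ⟧ ≡ ⟦ b ⟧ * ⟦ c ⟧
⟦∧⟧ true  c = sym (*-identityˡ ⟦ c ⟧)
⟦∧⟧ false c = sym (*-zeroˡ ⟦ c ⟧)

⟦==∨==⟧ : ∀ {n} {i j : Fin n} → i ≢ j → ∀ v → ⟦ (v == i) ∨ (v == j) ⟧ ≡ ⟦ v == i ⟧ + ⟦ v == j ⟧
⟦==∨==⟧ {i = i} {j} i≢j v with v ≟ i | v ≟ j
... | yes refl | yes refl = ⊥-elim (i≢j refl)
... | yes refl | no _ = refl
... | no _ | yes refl = refl
... | no _ | no _ = refl

⟦==⟧*⟦==⟧ : ∀ {n} (u v i : Fin n) → ⟦ u == i ⟧ * ⟦ v == i ⟧ ≡ ⟦ u == v ⟧ * ⟦ u == i ⟧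
⟦==⟧*⟦==⟧ u v i with u ≟ i
... | yes refl = trans (*-identityˡ ⟦ v == u ⟧) (trans (cong ⟦_⟧ (==-sym v u)) (sym (*-identityʳ ⟦ u == v ⟧)))
... | no _ = trans (*-zeroˡ ⟦ v == i ⟧) (sym (*-zeroʳ ⟦ u == v ⟧))

I-⟦==⟧ : ∀ {n} (i j : Fin n) → I i j ≡ ⟦ i == j ⟧
I-⟦==⟧ i j with i == j
... | true = refl
... | false = refl

diag-⟦==⟧ : ∀ {n} (d : Fin n → ℚ) (i j : Fin n) → diag d i j ≡ ⟦ i == j ⟧ * d i
diag-⟦==⟧ d i j with i == j
... | true = sym (*-identityˡ (d i))
... | false = sym (*-zeroˡ (d i))

∑-δ : ∀ {n} (i : Fin n) (f : Fin n → ℚ) → ∑ (λ j → ⟦ i == j ⟧ * f j) ≡ f i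
∑-δ {suc n} zero f = begin
  1ℚ * f zero + ∑ (λ j → ⟦ zero == suc j ⟧ * f (suc j))
    ≡⟨ cong₂ _+_ (*-identityˡ (f zero))
                 (∑-zero _ (λ j → trans (cong (λ b → ⟦ b ⟧ * f (suc j)) (≢⇒==false {i = zero} {suc j} (λ ()))) (*-zeroˡ (f (suc j))))) ⟩
  f zero + 0ℚ ≡⟨ +-identityʳ _ ⟩
  f zero ∎
∑-δ {suc n} (suc i) f = begin
  ⟦ suc i == zero ⟧ * f zero + ∑ (λ j → ⟦ suc i == suc j ⟧ * f (suc j))
    ≡⟨ cong₂ _+_ (trans (cong (λ b → ⟦ b ⟧ * f zero) (≢⇒==false {i = suc i} {zero} (λ ()))) (*-zeroˡ (f zero)))
                 (∑-cong (λ j → cong (λ b → ⟦ b ⟧ * f (suc j)) (==-injective suc suc-injective i j))) ⟩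
  0ℚ + ∑ (λ j → ⟦ i == j ⟧ * f (suc j)) ≡⟨ +-identityˡ _ ⟩
  ∑ (λ j → ⟦ i == j ⟧ * f (suc j))      ≡⟨ ∑-δ i (f ∘ suc) ⟩
  f (suc i) ∎

∑-δʳ : ∀ {n} (i : Fin n) (f : Fin n → ℚ) → ∑ (λ j → f j * ⟦ i == j ⟧) ≡ f i
∑-δʳ i f = trans (∑-cong (λ j → *-comm (f j) ⟦ i == j ⟧)) (∑-δ i f)

∑∑-δ : ∀ {m n} (u : Fin m) (F : Fin m → Fin n → ℚ) → ∑ (λ i → ∑ (λ j → F i j * ⟦ u == i ⟧)) ≡ ∑ (F u)
∑∑-δ u F = trans (∑-cong (λ i → trans (∑-cong (λ j → *-comm (F i j) ⟦ u == i ⟧)) (∑-*ˡ ⟦ u == i ⟧ (F i))))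
                 (∑-δ u (∑ ∘ F))

∑-⟦==⟧ : ∀ {n} (c : Fin n) → ∑ (λ v → ⟦ v == c ⟧) ≡ 1ℚ
∑-⟦==⟧ c = trans (∑-cong (λ v → trans (cong ⟦_⟧ (==-sym v c)) (sym (*-identityʳ _)))) (∑-δ c (λ _ → 1ℚ))

minor : ∀ {n} → Mat (suc n) → Fin (suc n) → Mat n
minor M j r c = M (suc r) (punchIn j c)

laplaceTerm : ∀ {n} → Mat (suc n) → Fin (suc n) → ℚ
laplaceTerm M j = sign (toℕ j) * (M zero j * det (minor M j))

laplaceTerm-minor-zero : ∀ {n} (M : Mat (suc n)) j → det (minor M j) ≡ 0ℚ → laplaceTerm M j ≡ 0ℚ
laplaceTerm-minor-zero M j d≡0 = begin
  sign (toℕ j) * (M zero j * det (minor M j)) ≡⟨ cong (λ d → sign (toℕ j) * (M zero j * d)) d≡0 ⟩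
  sign (toℕ j) * (M zero j * 0ℚ)              ≡⟨ solve 2 (λ s m → s :* (m :* con 0ℚ) := con 0ℚ) refl (sign (toℕ j)) (M zero j) ⟩
  0ℚ ∎

det-cong : ∀ {n} {M N : Mat n} → (∀ i j → M i j ≡ N i j) → det M ≡ det N
det-cong {zero}  e = refl
det-cong {suc n} e =
  ∑-cong (λ j → cong₂ (λ x y → sign (toℕ j) * (x * y)) (e zero j) (det-cong (λ r c → e (suc r) (punchIn j c))))

withCol : ∀ {n} → Mat n → Fin n → (Fin n → ℚ) → Mat n
withCol M j f i c = if c == j then f i else M i c

withCol-at : ∀ {n} (M : Mat n) j f i → withCol M j f i j ≡ f i
withCol-at M j f i rewrite ==-refl j = refl

withCol-off : ∀ {n} (M : Mat n) {j c} f i → c ≢ j → withCol M j f i c ≡ M i c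
withCol-off M f i c≢j rewrite ≢⇒==false c≢j = refl

withCol-comm : ∀ {n} (M : Mat n) {j s : Fin n} → j ≢ s → (u v : Fin n → ℚ) →
               ∀ r c → withCol (withCol M s v) j u r c ≡ withCol (withCol M j u) s v r c
withCol-comm M {j} {s} j≢s u v r c with c ≟ j | c ≟ s
... | yes refl | yes refl = ⊥-elim (j≢s refl)
... | yes refl | no _ = refl
... | no _ | yes refl = refl
... | no _ | no _ = refl

minor-withCol-same : ∀ {n} (M : Mat (suc n)) c f r c′ → minor (withCol M c f) c r c′ ≡ minor M c r c′
minor-withCol-same M c f r c′ = withCol-off M f (suc r) (punchInᵢ≢i c c′)

minor-withCol-other : ∀ {n} (M : Mat (suc n)) {c j} (c≢j : c ≢ j) f r c′ →
                      minor (withCol M j f) c r c′ ≡ withCol (minor M c) (punchOut c≢j) (f ∘ suc) r c′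
minor-withCol-other M {c} c≢j f r c′ = cong (λ b → if b then f (suc r) else M (suc r) (punchIn c c′)) same-test
  where
  same-test : (punchIn c c′ == _) ≡ (c′ == punchOut c≢j)
  same-test = trans (cong (punchIn c c′ ==_) (sym (punchIn-punchOut c≢j)))
                    (==-injective (punchIn c) (punchIn-injective c _ _) c′ (punchOut c≢j))

det-linear-col : ∀ {n} (M : Mat n) (j : Fin n) (a b : ℚ) (f g : Fin n → ℚ) →
  det (withCol M j (λ i → a * f i + b * g i)) ≡ a * det (withCol M j f) + b * det (withCol M j g)
det-linear-col {suc n} M j a b f g =
  trans (∑-cong (λ c → term c (c ≟ j)))
        (trans (∑-+ (λ c → a * laplaceTerm (withCol M j f) c) (λ c → b * laplaceTerm (withCol M j g) c))
               (cong₂ _+_ (∑-*ˡ a (laplaceTerm (withCol M j f))) (∑-*ˡ b (laplaceTerm (withCol M j g)))))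
  where
  h = λ i → a * f i + b * g i
  term : ∀ c → Dec (c ≡ j) → laplaceTerm (withCol M j h) c
                            ≡ a * laplaceTerm (withCol M j f) c + b * laplaceTerm (withCol M j g) c
  term c (yes refl) = begin
    laplaceTerm (withCol M c h) c                                   ≡⟨ at h ⟩
    sign (toℕ c) * ((a * f zero + b * g zero) * det (minor M c))
      ≡⟨ solve 6 (λ s a b x y d → s :* ((a :* x :+ b :* y) :* d) := a :* (s :* (x :* d)) :+ b :* (s :* (y :* d)))
               refl (sign (toℕ c)) a b (f zero) (g zero) (det (minor M c)) ⟩
    a * (sign (toℕ c) * (f zero * det (minor M c))) + b * (sign (toℕ c) * (g zero * det (minor M c)))
      ≡⟨ sym (cong₂ (λ x y → a * x + b * y) (at f) (at g)) ⟩
    a * laplaceTerm (withCol M c f) c + b * laplaceTerm (withCol M c g) c ∎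
    where
    at : ∀ k → laplaceTerm (withCol M c k) c ≡ sign (toℕ c) * (k zero * det (minor M c))
    at k = cong₂ (λ x y → sign (toℕ c) * (x * y)) (withCol-at M c k zero) (det-cong (minor-withCol-same M c k))
  term c (no c≢j) = begin
    laplaceTerm (withCol M j h) c                                        ≡⟨ off h ⟩
    sign (toℕ c) * (M zero c * det (withCol (minor M c) j′ (h ∘ suc)))
      ≡⟨ cong (λ d → sign (toℕ c) * (M zero c * d)) (det-linear-col (minor M c) j′ a b (f ∘ suc) (g ∘ suc)) ⟩
    sign (toℕ c) * (M zero c * (a * det (withCol (minor M c) j′ (f ∘ suc)) + b * det (withCol (minor M c) j′ (g ∘ suc))))
      ≡⟨ solve 6 (λ s e a b x y → s :* (e :* (a :* x :+ b :* y)) := a :* (s :* (e :* x)) :+ b :* (s :* (e :* y)))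
               refl (sign (toℕ c)) (M zero c) a b _ _ ⟩
    a * (sign (toℕ c) * (M zero c * det (withCol (minor M c) j′ (f ∘ suc))))
      + b * (sign (toℕ c) * (M zero c * det (withCol (minor M c) j′ (g ∘ suc))))
      ≡⟨ sym (cong₂ (λ x y → a * x + b * y) (off f) (off g)) ⟩
    a * laplaceTerm (withCol M j f) c + b * laplaceTerm (withCol M j g) c ∎
    where
    j′ = punchOut c≢j
    off : ∀ k → laplaceTerm (withCol M j k) c ≡ sign (toℕ c) * (M zero c * det (withCol (minor M c) j′ (k ∘ suc)))
    off k = cong₂ (λ x y → sign (toℕ c) * (x * y)) (withCol-off M k zero c≢j) (det-cong (minor-withCol-other M c≢j k))

det-+-col : ∀ {n} (M : Mat n) (j : Fin n) (f g : Fin n → ℚ) →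
            det (withCol M j (λ i → f i + g i)) ≡ det (withCol M j f) + det (withCol M j g)
det-+-col M j f g = begin
  det (withCol M j (λ i → f i + g i))
    ≡⟨ det-cong (λ r c → cong (λ x → if c == j then x else M r c) (sym (cong₂ _+_ (*-identityˡ (f r)) (*-identityˡ (g r))))) ⟩
  det (withCol M j (λ i → 1ℚ * f i + 1ℚ * g i))     ≡⟨ det-linear-col M j 1ℚ 1ℚ f g ⟩
  1ℚ * det (withCol M j f) + 1ℚ * det (withCol M j g) ≡⟨ cong₂ _+_ (*-identityˡ (det (withCol M j f))) (*-identityˡ (det (withCol M j g))) ⟩
  det (withCol M j f) + det (withCol M j g) ∎

det-zero-col : ∀ {n} (M : Mat n) (j : Fin n) → (∀ r → M r j ≡ 0ℚ) → det M ≡ 0ℚ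
det-zero-col M j z = begin
  det M                                   ≡⟨ det-cong as-withCol ⟩
  det (withCol M j (λ _ → 0ℚ * 0ℚ + 0ℚ * 0ℚ)) ≡⟨ det-linear-col M j 0ℚ 0ℚ zeros zeros ⟩
  0ℚ * d₀ + 0ℚ * d₀                       ≡⟨ solve 1 (λ d → con 0ℚ :* d :+ con 0ℚ :* d := con 0ℚ) refl d₀ ⟩
  0ℚ ∎
  where
  zeros = λ (_ : Fin _) → 0ℚ
  d₀ = det (withCol M j zeros)
  as-withCol : ∀ r c → M r c ≡ withCol M j (λ _ → 0ℚ * 0ℚ + 0ℚ * 0ℚ) r c
  as-withCol r c with c ≟ j
  ... | yes refl = z r
  ... | no _ = refl

det-linear-∑-col : ∀ {n m} (M : Mat n) (j : Fin n) (t : Fin m → ℚ) (G : Fin m → Fin n → ℚ) →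
  det (withCol M j (λ r → ∑ (λ l → t l * G l r))) ≡ ∑ (λ l → t l * det (withCol M j (G l)))
det-linear-∑-col {m = zero}  M j t G = det-zero-col _ j (withCol-at M j _)
det-linear-∑-col {m = suc m} M j t G = begin
  det (withCol M j (λ r → t zero * G zero r + ∑ (λ l → t (suc l) * G (suc l) r)))
    ≡⟨ det-cong (λ r c → cong (λ x → if c == j then x else M r c) (cong (t zero * G zero r +_) (sym (*-identityˡ _)))) ⟩
  det (withCol M j (λ r → t zero * G zero r + 1ℚ * ∑ (λ l → t (suc l) * G (suc l) r)))
    ≡⟨ det-linear-col M j (t zero) 1ℚ (G zero) _ ⟩
  t zero * det (withCol M j (G zero)) + 1ℚ * det (withCol M j (λ r → ∑ (λ l → t (suc l) * G (suc l) r)))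
    ≡⟨ cong (t zero * det (withCol M j (G zero)) +_) (trans (*-identityˡ _) (det-linear-∑-col M j (t ∘ suc) (G ∘ suc))) ⟩
  t zero * det (withCol M j (G zero)) + ∑ (λ l → t (suc l) * det (withCol M j (G (suc l)))) ∎

∑-pair : ∀ {n} (T : Fin n → ℚ) (a b : Fin n) → a ≢ b → (∀ c → c ≢ a → c ≢ b → T c ≡ 0ℚ) → ∑ T ≡ T a + T b
∑-pair T a b a≢b rest =
  trans (∑-cong split) (trans (∑-+ (λ c → ⟦ a == c ⟧ * T c) (λ c → ⟦ b == c ⟧ * T c)) (cong₂ _+_ (∑-δ a T) (∑-δ b T)))
  where
  split : ∀ c → T c ≡ ⟦ a == c ⟧ * T c + ⟦ b == c ⟧ * T c
  split c with c ≟ a | c ≟ b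
  ... | yes refl | yes refl = ⊥-elim (a≢b refl)
  ... | yes refl | no c≢b rewrite ==-refl c | ≢⇒==false (c≢b ∘ sym) =
    solve 1 (λ t → t := con 1ℚ :* t :+ con 0ℚ :* t) refl (T c)
  ... | no c≢a | yes refl rewrite ==-refl c | ≢⇒==false (c≢a ∘ sym) =
    solve 1 (λ t → t := con 0ℚ :* t :+ con 1ℚ :* t) refl (T c)
  ... | no c≢a | no c≢b rewrite rest c c≢a c≢b =
    solve 2 (λ p q → con 0ℚ := p :* con 0ℚ :+ q :* con 0ℚ) refl ⟦ a == c ⟧ ⟦ b == c ⟧

inject₁≢suc : ∀ {n} (i : Fin n) → inject₁ i ≢ suc i
inject₁≢suc zero    ()
inject₁≢suc (suc i) e = inject₁≢suc i (suc-injective e)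

punchIn-preimage-adjacent : ∀ {n} (c : Fin (suc (suc n))) (i : Fin (suc n)) → c ≢ inject₁ i → c ≢ suc i →
  Σ (Fin n) λ k → punchIn c (inject₁ k) ≡ inject₁ i × punchIn c (suc k) ≡ suc i
punchIn-preimage-adjacent zero zero p q = ⊥-elim (p refl)
punchIn-preimage-adjacent zero (suc i) p q = i , refl , refl
punchIn-preimage-adjacent (suc zero) zero p q = ⊥-elim (q refl)
punchIn-preimage-adjacent {suc n} (suc (suc c)) zero p q = zero , refl , refl
punchIn-preimage-adjacent {suc n} (suc c) (suc i) p q
  with punchIn-preimage-adjacent c i (p ∘ cong suc) (q ∘ cong suc)
... | k , e₁ , e₂ = suc k , cong suc e₁ , cong suc e₂

punchIn-inject₁-suc : ∀ {n} (i : Fin n) (c : Fin n) →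
  punchIn (inject₁ i) c ≡ punchIn (suc i) c ⊎ (punchIn (inject₁ i) c ≡ suc i × punchIn (suc i) c ≡ inject₁ i)
punchIn-inject₁-suc zero    zero    = inj₂ (refl , refl)
punchIn-inject₁-suc zero    (suc c) = inj₁ refl
punchIn-inject₁-suc (suc i) zero    = inj₁ refl
punchIn-inject₁-suc (suc i) (suc c) with punchIn-inject₁-suc i c
... | inj₁ e = inj₁ (cong suc e)
... | inj₂ (e₁ , e₂) = inj₂ (cong suc e₁ , cong suc e₂)

-- Every other Laplace term has two equal adjacent columns in its minor; the two remaining terms cancel.
det-equal-adjacent-cols : ∀ {n} (M : Mat (suc n)) (i : Fin n) → (∀ r → M r (inject₁ i) ≡ M r (suc i)) → det M ≡ 0ℚ
det-equal-adjacent-cols {suc n} M i eq =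
  trans (∑-pair (laplaceTerm M) (inject₁ i) (suc i) (inject₁≢suc i) others) cancel
  where
  others : ∀ c → c ≢ inject₁ i → c ≢ suc i → laplaceTerm M c ≡ 0ℚ
  others c p q with punchIn-preimage-adjacent c i p q
  ... | k , e₁ , e₂ = laplaceTerm-minor-zero M c (det-equal-adjacent-cols (minor M c) k
        (λ r → trans (cong (M (suc r)) e₁) (trans (eq (suc r)) (cong (M (suc r)) (sym e₂)))))
  same-minor : ∀ r c → minor M (inject₁ i) r c ≡ minor M (suc i) r c
  same-minor r c with punchIn-inject₁-suc i c
  ... | inj₁ e = cong (M (suc r)) e
  ... | inj₂ (e₁ , e₂) = trans (cong (M (suc r)) e₁) (trans (sym (eq (suc r))) (cong (M (suc r)) (sym e₂)))
  s = sign (toℕ i)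
  x = M zero (suc i)
  d = det (minor M (suc i))
  cancel : laplaceTerm M (inject₁ i) + laplaceTerm M (suc i) ≡ 0ℚ
  cancel = begin
    sign (toℕ (inject₁ i)) * (M zero (inject₁ i) * det (minor M (inject₁ i))) + - s * (x * d)
      ≡⟨ cong₂ (λ t y → sign t * (y * det (minor M (inject₁ i))) + - s * (x * d)) (toℕ-inject₁ i) (eq zero) ⟩
    s * (x * det (minor M (inject₁ i))) + - s * (x * d)
      ≡⟨ cong (λ y → s * (x * y) + - s * (x * d)) (det-cong same-minor) ⟩
    s * (x * d) + - s * (x * d)
      ≡⟨ solve 3 (λ s x d → s :* (x :* d) :+ (:- s) :* (x :* d) := con 0ℚ) refl s x d ⟩
    0ℚ ∎

-- Expand both swapped columns by linearity; the two terms with a repeated column vanish.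
det-swap-adjacent : ∀ {n} (M M′ : Mat (suc n)) (i : Fin n) →
  (∀ r c → c ≢ inject₁ i → c ≢ suc i → M′ r c ≡ M r c) →
  (∀ r → M′ r (inject₁ i) ≡ M r (suc i)) → (∀ r → M′ r (suc i) ≡ M r (inject₁ i)) →
  det M′ ≡ - det M
det-swap-adjacent {n} M M′ i e₀ e₁ e₂ = begin
  det M′                                ≡⟨ solve 2 (λ a b → a := (a :+ b) :+ :- b) refl (det M′) (det M) ⟩
  (det M′ + det M) + - det M            ≡⟨ cong (_+ - det M) sum-zero ⟩
  0ℚ + - det M                          ≡⟨ +-identityˡ _ ⟩
  - det M ∎
  where
  j = inject₁ i
  s = suc i
  j≢s = inject₁≢suc i
  X = λ r → M r j
  Y = λ r → M r s
  XY = λ r → X r + Y r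
  N : (Fin (suc n) → ℚ) → (Fin (suc n) → ℚ) → Mat (suc n)
  N u v = withCol (withCol M s v) j u
  linU : ∀ u₁ u₂ v → det (N (λ r → u₁ r + u₂ r) v) ≡ det (N u₁ v) + det (N u₂ v)
  linU u₁ u₂ v = det-+-col (withCol M s v) j u₁ u₂
  linV : ∀ u v₁ v₂ → det (N u (λ r → v₁ r + v₂ r)) ≡ det (N u v₁) + det (N u v₂)
  linV u v₁ v₂ = trans (det-cong (withCol-comm M j≢s u (λ r → v₁ r + v₂ r)))
                 (trans (det-+-col (withCol M j u) s v₁ v₂)
                   (sym (cong₂ _+_ (det-cong (withCol-comm M j≢s u v₁)) (det-cong (withCol-comm M j≢s u v₂)))))
  repeated : ∀ w → det (N w w) ≡ 0ℚ
  repeated w = det-equal-adjacent-cols (N w w) i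
    (λ r → trans (withCol-at (withCol M s w) j w r) (sym (trans (withCol-off (withCol M s w) w r (j≢s ∘ sym)) (withCol-at M s w r))))
  N-XY : ∀ r c → N X Y r c ≡ M r c
  N-XY r c with c ≟ j | c ≟ s
  ... | yes refl | _ = refl
  ... | no _ | yes refl = refl
  ... | no _ | no _ = refl
  N-YX : ∀ r c → N Y X r c ≡ M′ r c
  N-YX r c with c ≟ j | c ≟ s
  ... | yes refl | _ = sym (e₁ r)
  ... | no _ | yes refl = sym (e₂ r)
  ... | no p | no q = sym (e₀ r c p q)
  sum-zero : det M′ + det M ≡ 0ℚ
  sum-zero = begin
    det M′ + det M ≡⟨ sym (cong₂ _+_ (det-cong N-YX) (det-cong N-XY)) ⟩
    det (N Y X) + det (N X Y)
      ≡⟨ solve 2 (λ a b → a :+ b := (con 0ℚ :+ a) :+ (b :+ con 0ℚ)) refl (det (N Y X)) (det (N X Y)) ⟩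
    (0ℚ + det (N Y X)) + (det (N X Y) + 0ℚ)
      ≡⟨ sym (cong₂ (λ a b → (a + det (N Y X)) + (det (N X Y) + b)) (repeated X) (repeated Y)) ⟩
    (det (N X X) + det (N Y X)) + (det (N X Y) + det (N Y Y))
      ≡⟨ solve 4 (λ a b c d → (a :+ b) :+ (c :+ d) := (a :+ c) :+ (b :+ d)) refl
               (det (N X X)) (det (N Y X)) (det (N X Y)) (det (N Y Y)) ⟩
    (det (N X X) + det (N X Y)) + (det (N Y X) + det (N Y Y)) ≡⟨ sym (cong₂ _+_ (linV X X Y) (linV Y X Y)) ⟩
    det (N X XY) + det (N Y XY) ≡⟨ sym (linU X Y XY) ⟩
    det (N XY XY) ≡⟨ repeated XY ⟩
    0ℚ ∎

swapAdjacent : ∀ {n} → Fin n → Fin (suc n) → Fin (suc n)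
swapAdjacent k c = if c == inject₁ k then suc k else if c == suc k then inject₁ k else c

swapAdjacent-inject₁ : ∀ {n} (k : Fin n) → swapAdjacent k (inject₁ k) ≡ suc k
swapAdjacent-inject₁ k rewrite ==-refl (inject₁ k) = refl

swapAdjacent-suc : ∀ {n} (k : Fin n) → swapAdjacent k (suc k) ≡ inject₁ k
swapAdjacent-suc k rewrite ≢⇒==false (inject₁≢suc k ∘ sym) | ==-refl (suc k) = refl

swapAdjacent-other : ∀ {n} (k : Fin n) {c} → c ≢ inject₁ k → c ≢ suc k → swapAdjacent k c ≡ c
swapAdjacent-other k c≢k c≢sk rewrite ≢⇒==false c≢k | ≢⇒==false c≢sk = refl

-- Induction on the distance d between the equal columns, moving one of them by an adjacent swap.
det-equal-cols-at-distance : ∀ d {n} (M : Mat (suc n)) (j : Fin (suc n)) (k : Fin n) → toℕ k ≡ d ℕ.+ toℕ j →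
  (∀ r → M r j ≡ M r (suc k)) → det M ≡ 0ℚ
det-equal-cols-at-distance zero M j k k≡j eq =
  det-equal-adjacent-cols M k (λ r → trans (cong (M r) (sym j≡k)) (eq r))
  where
  j≡k : j ≡ inject₁ k
  j≡k = toℕ-injective (sym (trans (toℕ-inject₁ k) k≡j))
det-equal-cols-at-distance (suc d) {suc n} M j (suc k₁) dist eq = begin
  det M     ≡⟨ solve 1 (λ x → x := :- (:- x)) refl (det M) ⟩
  - - det M ≡⟨ cong -_ (sym swapped) ⟩
  - det M′  ≡⟨ cong -_ closer ⟩
  - 0ℚ      ≡⟨⟩
  0ℚ ∎
  where
  k = suc k₁
  M′ : Mat (suc (suc n))
  M′ r c = M r (swapAdjacent k c)
  j≢k : j ≢ inject₁ k
  j≢k p = ℕP.m≢1+n+m (toℕ j) {d} (trans (cong toℕ p) (trans (toℕ-inject₁ k) dist))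
  j≢sk : j ≢ suc k
  j≢sk p = ℕP.m≢1+n+m (toℕ j) {suc d} (trans (cong toℕ p) (cong suc dist))
  swapped : det M′ ≡ - det M
  swapped = det-swap-adjacent M M′ k
    (λ r c p q → cong (M r) (swapAdjacent-other k p q))
    (λ r → cong (M r) (swapAdjacent-inject₁ k))
    (λ r → cong (M r) (swapAdjacent-suc k))
  closer : det M′ ≡ 0ℚ
  closer = det-equal-cols-at-distance d M′ j (inject₁ k₁) (trans (toℕ-inject₁ k₁) (ℕP.suc-injective dist))
    (λ r → trans (cong (M r) (swapAdjacent-other k j≢k j≢sk))
                 (trans (eq r) (cong (M r) (sym (swapAdjacent-inject₁ k)))))

det-equal-cols-< : ∀ {n} (M : Mat n) (j k : Fin n) → toℕ j ℕ.< toℕ k → (∀ r → M r j ≡ M r k) → det M ≡ 0ℚ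
det-equal-cols-< {suc n} M j (suc k) (ℕ.s≤s j≤k) =
  det-equal-cols-at-distance (toℕ k ℕ.∸ toℕ j) M j k (sym (ℕP.m∸n+n≡m j≤k))

det-equal-cols : ∀ {n} (M : Mat n) (j k : Fin n) → j ≢ k → (∀ r → M r j ≡ M r k) → det M ≡ 0ℚ
det-equal-cols M j k j≢k eq with ℕP.<-cmp (toℕ j) (toℕ k)
... | tri< j<k _ _ = det-equal-cols-< M j k j<k eq
... | tri≈ _ j≡k _ = ⊥-elim (j≢k (toℕ-injective j≡k))
... | tri> _ _ k<j = det-equal-cols-< M k j k<j (sym ∘ eq)

det-add-col-combination : ∀ {n} (M : Mat n) (j : Fin n) (t : Fin n → ℚ) → t j ≡ 0ℚ →
  det (withCol M j (λ r → M r j + ∑ (λ l → t l * M r l))) ≡ det M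
det-add-col-combination M j t tj≡0 = begin
  det (withCol M j (λ r → M r j + ∑ (λ l → t l * M r l)))
    ≡⟨ det-+-col M j (λ r → M r j) (λ r → ∑ (λ l → t l * M r l)) ⟩
  det (withCol M j (λ r → M r j)) + det (withCol M j (λ r → ∑ (λ l → t l * M r l)))
    ≡⟨ cong₂ _+_ (det-cong unchanged) (trans (det-linear-∑-col M j t (λ l r → M r l)) (∑-zero _ vanishes)) ⟩
  det M + 0ℚ ≡⟨ +-identityʳ _ ⟩
  det M ∎
  where
  unchanged : ∀ r c → withCol M j (λ r → M r j) r c ≡ M r c
  unchanged r c with c ≟ j
  ... | yes refl = refl
  ... | no _ = refl
  vanishes : ∀ l → t l * det (withCol M j (λ r → M r l)) ≡ 0ℚ
  vanishes l with l ≟ j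
  ... | yes refl = trans (cong (_* det (withCol M l (λ r → M r l))) tj≡0) (*-zeroˡ (det (withCol M l (λ r → M r l))))
  ... | no l≢j = trans (cong (t l *_) (det-equal-cols _ j l (l≢j ∘ sym)
                         (λ r → trans (withCol-at M j colₗ r) (sym (withCol-off M colₗ r l≢j)))))
                       (*-zeroʳ (t l))
    where colₗ = λ r → M r l

addCols : ∀ {n} → Mat n → (Fin n → Fin n → ℚ) → Mat n
addCols M T r c = M r c + ∑ (λ l → M r l * T l c)

addCols-unchanged : ∀ {n} (M : Mat n) (T : Fin n → Fin n → ℚ) c → (∀ l → T l c ≡ 0ℚ) → ∀ r → addCols M T r c ≡ M r c
addCols-unchanged M T c T≡0 r =
  trans (cong (M r c +_) (∑-zero _ (λ l → trans (cong (M r l *_) (T≡0 l)) (*-zeroʳ (M r l))))) (+-identityʳ _)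

-- The columns of S are processed one at a time, in decreasing order, each by det-add-col-combination.
det-add-cols-below : ∀ k {n} (M : Mat n) (T : Fin n → Fin n → ℚ) (S : Fin n → Bool) →
  (∀ c → S c ≡ true → toℕ c ℕ.< k) →
  (∀ l c → S c ≡ false → T l c ≡ 0ℚ) → (∀ l c → S l ≡ true → T l c ≡ 0ℚ) →
  det (addCols M T) ≡ det M
det-add-cols-below zero M T S below into from = det-cong (λ r c → addCols-unchanged M T c (λ l → into l c (outside c)) r)
  where
  outside : ∀ c → S c ≡ false
  outside c with S c in eq
  ... | true = ⊥-elim (ℕP.n≮0 (below c eq))
  ... | false = refl
det-add-cols-below (suc k) {n} M T S below into from with k ℕP.<? n
... | no k≮n = det-add-cols-below k M T S (λ c _ → ℕP.<-≤-trans (toℕ<n c) (ℕP.≮⇒≥ k≮n)) into from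
... | yes k<n = begin
  det (addCols M T)                                              ≡⟨ det-cong last-step ⟩
  det (withCol M′ c₀ (λ r → M′ r c₀ + ∑ (λ l → T l c₀ * M′ r l))) ≡⟨ det-add-col-combination M′ c₀ (λ l → T l c₀) Tc₀c₀≡0 ⟩
  det M′                                                         ≡⟨ det-add-cols-below k M T′ S′ below′ into′ from′ ⟩
  det M ∎
  where
  c₀ = fromℕ< k<n
  S′ : Fin n → Bool
  S′ c = S c ∧ not (c == c₀)
  T′ : Fin n → Fin n → ℚ
  T′ l c = if c == c₀ then 0ℚ else T l c
  M′ = addCols M T′
  Tc₀c₀≡0 : T c₀ c₀ ≡ 0ℚ
  Tc₀c₀≡0 with S c₀ in eq
  ... | true = from c₀ c₀ eq
  ... | false = into c₀ c₀ eq
  below′ : ∀ c → S′ c ≡ true → toℕ c ℕ.< k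
  below′ c e with S c in eS | c ≟ c₀
  below′ c () | true | yes _
  ... | true | no c≢c₀ = ℕP.≤∧≢⇒< (ℕ.s≤s⁻¹ (below c eS)) (λ x → c≢c₀ (toℕ-injective (trans x (sym (toℕ-fromℕ< k<n)))))
  below′ c () | false | _
  into′ : ∀ l c → S′ c ≡ false → T′ l c ≡ 0ℚ
  into′ l c e with c ≟ c₀ | S c in eS
  ... | yes _ | _ = refl
  ... | no _ | false = into l c eS
  into′ l c () | no _ | true
  from′ : ∀ l c → S′ l ≡ true → T′ l c ≡ 0ℚ
  from′ l c e with c ≟ c₀ | S l in eS
  ... | yes _ | _ = refl
  ... | no _ | true = from l c eS
  from′ l c e | no _ | false with l ≟ c₀
  from′ l c () | no _ | false | yes _
  from′ l c () | no _ | false | no _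
  weights-commute : ∀ r l → T l c₀ * M′ r l ≡ M r l * T l c₀
  weights-commute r l with S l in eS
  ... | true = trans (cong (_* M′ r l) (from l c₀ eS))
                     (trans (*-zeroˡ (M′ r l)) (sym (trans (cong (M r l *_) (from l c₀ eS)) (*-zeroʳ (M r l)))))
  ... | false = trans (cong (T l c₀ *_) (addCols-unchanged M T′ l (λ l′ → into′ l′ l S′l≡false) r)) (*-comm (T l c₀) (M r l))
    where
    S′l≡false : S′ l ≡ false
    S′l≡false rewrite eS = refl
  last-step : ∀ r c → addCols M T r c ≡ withCol M′ c₀ (λ r → M′ r c₀ + ∑ (λ l → T l c₀ * M′ r l)) r c
  last-step r c with c ≟ c₀
  ... | yes refl = sym (cong₂ _+_ (addCols-unchanged M T′ c₀ (λ l → cong (λ b → if b then 0ℚ else T l c₀) (==-refl c₀)) r)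
                                  (∑-cong (weights-commute r)))
  ... | no _ = refl

det-add-cols : ∀ {n} (M : Mat n) (T : Fin n → Fin n → ℚ) (S : Fin n → Bool) →
  (∀ l c → S c ≡ false → T l c ≡ 0ℚ) → (∀ l c → S l ≡ true → T l c ≡ 0ℚ) →
  det (addCols M T) ≡ det M
det-add-cols {n} M T S = det-add-cols-below n M T S (λ c _ → toℕ<n c)

punchIn-↑ˡ : ∀ {a} b (c : Fin (suc a)) (j : Fin a) → punchIn (c ↑ˡ b) (j ↑ˡ b) ≡ punchIn c j ↑ˡ b
punchIn-↑ˡ b zero    j       = refl
punchIn-↑ˡ b (suc c) zero    = refl
punchIn-↑ˡ b (suc c) (suc j) = cong suc (punchIn-↑ˡ b c j)

punchIn-↑ʳ : ∀ {a b} (c : Fin (suc a)) (j : Fin b) → punchIn (c ↑ˡ b) (a ↑ʳ j) ≡ suc a ↑ʳ j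
punchIn-↑ʳ         zero    j = refl
punchIn-↑ʳ {suc a} (suc c) j = cong suc (punchIn-↑ʳ c j)

toℕ-punchIn-≤ : ∀ {n} (p : Fin (suc n)) (c : Fin n) → toℕ (punchIn p c) ℕ.≤ suc (toℕ c)
toℕ-punchIn-≤ zero    c       = ℕP.≤-refl
toℕ-punchIn-≤ (suc p) zero    = ℕ.z≤n
toℕ-punchIn-≤ (suc p) (suc c) = ℕ.s≤s (toℕ-punchIn-≤ p c)

punchIn-↑ʳ-low : ∀ a {b} (j : Fin b) (c : Fin (a ℕ.+ b)) → toℕ c ℕ.≤ a →
  Σ (Fin (suc a)) λ k → punchIn (suc a ↑ʳ j) c ≡ k ↑ˡ b
punchIn-↑ʳ-low zero    j zero    _ = zero , refl
punchIn-↑ʳ-low (suc a) j zero    _ = zero , refl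
punchIn-↑ʳ-low (suc a) j (suc c) (ℕ.s≤s c≤a) with punchIn-↑ʳ-low a j c c≤a
... | k , e = suc k , cong suc e

det-zero-corner : ∀ a {b} (M : Mat (a ℕ.+ suc b)) → (∀ i c → toℕ c ℕ.≤ a → M (a ↑ʳ i) c ≡ 0ℚ) → det M ≡ 0ℚ
det-zero-corner zero    M z = det-zero-col M zero (λ r → z r zero ℕ.z≤n)
det-zero-corner (suc a) M z = ∑-zero _ (λ c → laplaceTerm-minor-zero M c
  (det-zero-corner a (minor M c) (λ i c′ c′≤a → z i (punchIn c c′) (ℕP.≤-trans (toℕ-punchIn-≤ c c′) (ℕ.s≤s c′≤a)))))

det-minor-lower-zero : ∀ a {b} (M : Mat (suc a ℕ.+ b)) → (∀ i j → M (suc a ↑ʳ i) (j ↑ˡ b) ≡ 0ℚ) →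
                       ∀ j → det (minor M (suc a ↑ʳ j)) ≡ 0ℚ
det-minor-lower-zero a {suc b} M z j = det-zero-corner a (minor M (suc a ↑ʳ j)) (λ i c c≤a →
  let (k , e) = punchIn-↑ʳ-low a j c c≤a in trans (cong (M (suc (a ↑ʳ i))) e) (z i k))

det-block-upper-triangular : ∀ a {b} (M : Mat (a ℕ.+ b)) → (∀ i j → M (a ↑ʳ i) (j ↑ˡ b) ≡ 0ℚ) →
  det M ≡ det (λ i j → M (i ↑ˡ b) (j ↑ˡ b)) * det (λ i j → M (a ↑ʳ i) (a ↑ʳ j))
det-block-upper-triangular zero    M z = sym (*-identityˡ (det M))
det-block-upper-triangular (suc a) {b} M z = begin
  ∑ (laplaceTerm M)
    ≡⟨ ∑-↑ (suc a) (laplaceTerm M) ⟩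
  ∑ (λ c → laplaceTerm M (c ↑ˡ b)) + ∑ (λ j → laplaceTerm M (suc a ↑ʳ j))
    ≡⟨ cong₂ _+_ (∑-cong left) (∑-zero _ (λ j → laplaceTerm-minor-zero M _ (det-minor-lower-zero a M z j))) ⟩
  ∑ (λ c → laplaceTerm TL c * det BR) + 0ℚ ≡⟨ +-identityʳ _ ⟩
  ∑ (λ c → laplaceTerm TL c * det BR)      ≡⟨ ∑-*ʳ (det BR) (laplaceTerm TL) ⟩
  det TL * det BR ∎
  where
  TL = λ i j → M (i ↑ˡ b) (j ↑ˡ b)
  BR = λ i j → M (suc a ↑ʳ i) (suc a ↑ʳ j)
  left : ∀ c → laplaceTerm M (c ↑ˡ b) ≡ laplaceTerm TL c * det BR
  left c = begin
    sign (toℕ (c ↑ˡ b)) * (M zero (c ↑ˡ b) * det (minor M (c ↑ˡ b)))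
      ≡⟨ cong₂ (λ x y → sign x * (M zero (c ↑ˡ b) * y)) (toℕ-↑ˡ c b)
           (det-block-upper-triangular a (minor M (c ↑ˡ b))
             (λ i j → trans (cong (M (suc (a ↑ʳ i))) (punchIn-↑ˡ b c j)) (z i (punchIn c j)))) ⟩
    sign (toℕ c) * (TL zero c * (det (λ i j → M (suc (i ↑ˡ b)) (punchIn (c ↑ˡ b) (j ↑ˡ b)))
                                 * det (λ i j → M (suc (a ↑ʳ i)) (punchIn (c ↑ˡ b) (a ↑ʳ j)))))
      ≡⟨ cong₂ (λ x y → sign (toℕ c) * (TL zero c * (x * y)))
           (det-cong (λ i j → cong (M (suc (i ↑ˡ b))) (punchIn-↑ˡ b c j)))
           (det-cong (λ i j → cong (M (suc (a ↑ʳ i))) (punchIn-↑ʳ c j))) ⟩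
    sign (toℕ c) * (TL zero c * (det (minor TL c) * det BR))
      ≡⟨ solve 4 (λ s x y z → s :* (x :* (y :* z)) := s :* (x :* y) :* z) refl
               (sign (toℕ c)) (TL zero c) (det (minor TL c)) (det BR) ⟩
    laplaceTerm TL c * det BR ∎

det-block-diagonal : ∀ m {n} (B : Mat (m ℕ.* n)) (M : Mat n) →
  (∀ (k k′ : Fin m) (w w′ : Fin n) → B (combine {m} {n} k w) (combine {m} {n} k′ w′) ≡ ⟦ k == k′ ⟧ * M w w′) →
  det B ≡ det M ^ m
det-block-diagonal zero    B M diagonal = refl
det-block-diagonal (suc m) {n} B M diagonal =
  trans (det-block-upper-triangular n B lower-zero) (cong₂ _*_ (det-cong first) (det-block-diagonal m _ M rest))
  where
  lower-zero : ∀ i j → B (n ↑ʳ i) (j ↑ˡ (m ℕ.* n)) ≡ 0ℚ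
  lower-zero i j = let (k , w) = remQuot {m} n i in
    trans (cong (λ x → B (n ↑ʳ x) (j ↑ˡ (m ℕ.* n))) (sym (combine-remQuot {m} n i)))
          (trans (diagonal (suc k) zero w j) (*-zeroˡ (M w j)))
  first : ∀ i j → B (i ↑ˡ (m ℕ.* n)) (j ↑ˡ (m ℕ.* n)) ≡ M i j
  first i j = trans (diagonal zero zero i j) (*-identityˡ (M i j))
  rest : ∀ (k k′ : Fin m) (w w′ : Fin n) → B (n ↑ʳ combine {m} {n} k w) (n ↑ʳ combine {m} {n} k′ w′) ≡ ⟦ k == k′ ⟧ * M w w′
  rest k k′ w w′ = trans (diagonal (suc k) (suc k′) w w′) (cong (λ x → ⟦ x ⟧ * M w w′) (==-injective suc suc-injective k k′))

∑ₗ : ∀ {A : Set} → List A → (A → ℚ) → ℚ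
∑ₗ []       g = 0ℚ
∑ₗ (a ∷ as) g = g a + ∑ₗ as g

∑-lookup : ∀ {A : Set} (xs : List A) (g : A → ℚ) → ∑ (λ k → g (lookup xs k)) ≡ ∑ₗ xs g
∑-lookup []       g = refl
∑-lookup (a ∷ as) g = cong (g a +_) (∑-lookup as g)

∑ₗ-filterᵇ : ∀ {A : Set} (p : A → Bool) (xs : List A) (g : A → ℚ) → ∑ₗ (filterᵇ p xs) g ≡ ∑ₗ xs (λ y → ⟦ p y ⟧ * g y)
∑ₗ-filterᵇ p []       g = refl
∑ₗ-filterᵇ p (a ∷ as) g with p a
... | true  = cong₂ _+_ (sym (*-identityˡ (g a))) (∑ₗ-filterᵇ p as g)
... | false = trans (∑ₗ-filterᵇ p as g) (sym (trans (cong (_+ _) (*-zeroˡ (g a))) (+-identityˡ _)))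

∑ₗ-++ : ∀ {A : Set} (xs ys : List A) (g : A → ℚ) → ∑ₗ (xs ++ ys) g ≡ ∑ₗ xs g + ∑ₗ ys g
∑ₗ-++ []       ys g = sym (+-identityˡ _)
∑ₗ-++ (a ∷ as) ys g = trans (cong (g a +_) (∑ₗ-++ as ys g)) (sym (+-assoc (g a) _ _))

∑ₗ-map : ∀ {A B : Set} (f : A → B) (xs : List A) (g : B → ℚ) → ∑ₗ (map f xs) g ≡ ∑ₗ xs (g ∘ f)
∑ₗ-map f []       g = refl
∑ₗ-map f (a ∷ as) g = cong (g (f a) +_) (∑ₗ-map f as g)

∑ₗ-cartesianProduct : ∀ {A B : Set} (xs : List A) (ys : List B) (g : A × B → ℚ) →
  ∑ₗ (cartesianProduct xs ys) g ≡ ∑ₗ xs (λ a → ∑ₗ ys (λ b → g (a , b)))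
∑ₗ-cartesianProduct []       ys g = refl
∑ₗ-cartesianProduct (a ∷ as) ys g =
  trans (∑ₗ-++ (map (a ,_) ys) _ g) (cong₂ _+_ (∑ₗ-map (a ,_) ys g) (∑ₗ-cartesianProduct as ys g))

∑ₗ-tabulate : ∀ {A : Set} n (f : Fin n → A) (g : A → ℚ) → ∑ₗ (tabulate f) g ≡ ∑ (g ∘ f)
∑ₗ-tabulate zero    f g = refl
∑ₗ-tabulate (suc n) f g = cong (g (f zero) +_) (∑ₗ-tabulate n (f ∘ suc) g)

∑-filtered-pairs : ∀ {n} (p : Fin n × Fin n → Bool) (g : Fin n × Fin n → ℚ) →
  ∑ (λ k → g (lookup (filterᵇ p (cartesianProduct (allFin n) (allFin n))) k))
    ≡ ∑ (λ i → ∑ (λ j → ⟦ p (i , j) ⟧ * g (i , j)))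
∑-filtered-pairs {n} p g = begin
  _ ≡⟨ ∑-lookup (filterᵇ p pairs) g ⟩
  ∑ₗ (filterᵇ p pairs) g                                  ≡⟨ ∑ₗ-filterᵇ p pairs g ⟩
  ∑ₗ pairs h                                              ≡⟨ ∑ₗ-cartesianProduct (allFin n) (allFin n) h ⟩
  ∑ₗ (allFin n) (λ i → ∑ₗ (allFin n) (λ j → h (i , j))) ≡⟨ ∑ₗ-tabulate n id _ ⟩
  ∑ (λ i → ∑ₗ (allFin n) (λ j → h (i , j)))              ≡⟨ ∑-cong (λ i → ∑ₗ-tabulate n id (λ j → h (i , j))) ⟩
  _ ∎
  where
  pairs = cartesianProduct (allFin n) (allFin n)
  h = λ y → ⟦ p y ⟧ * g y

lookup-filterᵇ : ∀ {A : Set} (p : A → Bool) (xs : List A) (k : Fin (length (filterᵇ p xs))) →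
                 p (lookup (filterᵇ p xs) k) ≡ true
lookup-filterᵇ p (a ∷ as) k with p a in eq
lookup-filterᵇ p (a ∷ as) zero    | true = eq
lookup-filterᵇ p (a ∷ as) (suc k) | true = lookup-filterᵇ p as k
... | false = lookup-filterᵇ p as k

charMat : ∀ {n} → Adj n → ℚ → Mat n
charMat a x = (x · I) ⊖ Lap a

charMat-entry : ∀ {n} (a : Adj n) x i j → charMat a x i j ≡ x * ⟦ i == j ⟧ - (⟦ i == j ⟧ * outdeg a i - ⟦ a i j ⟧)
charMat-entry a x i j = cong₂ (λ p q → x * p - (q - ⟦ a i j ⟧)) (I-⟦==⟧ i j) (diag-⟦==⟧ (outdeg a) i j)

charMat-off-diagonal : ∀ {n} (a : Adj n) x i j → (i == j) ≡ false → charMat a x i j ≡ ⟦ a i j ⟧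
charMat-off-diagonal a x i j i≠j = begin
  charMat a x i j                                           ≡⟨ charMat-entry a x i j ⟩
  x * ⟦ i == j ⟧ - (⟦ i == j ⟧ * outdeg a i - ⟦ a i j ⟧) ≡⟨ cong (λ b → x * ⟦ b ⟧ - (⟦ b ⟧ * outdeg a i - ⟦ a i j ⟧)) i≠j ⟩
  x * 0ℚ - (0ℚ * outdeg a i - ⟦ a i j ⟧)
    ≡⟨ solve 3 (λ x d c → x :* con 0ℚ :- (con 0ℚ :* d :- c) := c) refl x (outdeg a i) ⟦ a i j ⟧ ⟩
  ⟦ a i j ⟧ ∎

-- The rows of a Laplacian sum to zero.
charMat-row-sum : ∀ {n} (a : Adj n) x i → ∑ (charMat a x i) ≡ x
charMat-row-sum a x i = begin
  ∑ (charMat a x i)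
    ≡⟨ ∑-cong (λ j → trans (charMat-entry a x i j)
         (solve 4 (λ x e d c → x :* e :- (e :* d :- c) := e :* (x :- d) :+ c) refl x ⟦ i == j ⟧ (outdeg a i) ⟦ a i j ⟧)) ⟩
  ∑ (λ j → ⟦ i == j ⟧ * (x - outdeg a i) + ⟦ a i j ⟧)
    ≡⟨ ∑-+ (λ j → ⟦ i == j ⟧ * (x - outdeg a i)) (λ j → ⟦ a i j ⟧) ⟩
  ∑ (λ j → ⟦ i == j ⟧ * (x - outdeg a i)) + outdeg a i
    ≡⟨ cong (_+ outdeg a i) (∑-δ i (λ _ → x - outdeg a i)) ⟩
  (x - outdeg a i) + outdeg a i
    ≡⟨ solve 2 (λ x d → (x :- d) :+ d := x) refl x (outdeg a i) ⟩
  x ∎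

module ArcCorona {n₁ n₂ : ℕ} (a₁ : Adj n₁) (a₂ : Adj n₂) (es : List (Fin n₁ × Fin n₁))
                 (into : Fin n₁ → Fin n₁ × Fin n₁ → Bool) (outof : Fin n₁ × Fin n₁ → Fin n₁ → Bool) where

  m = length es
  K = m ℕ.* n₂
  C = corona a₁ a₂ es into outof

  base : Fin n₁ → Fin (n₁ ℕ.+ K)
  base u = u ↑ˡ K

  copy : Fin m → Fin n₂ → Fin (n₁ ℕ.+ K)
  copy k w = n₁ ↑ʳ combine {m} {n₂} k w

  e : Fin m → Fin n₁ × Fin n₁
  e = lookup es

  C-base-base : ∀ u v → C (base u) (base v) ≡ a₁ u v
  C-base-base u v rewrite splitAt-↑ˡ n₁ u K | splitAt-↑ˡ n₁ v K = refl

  C-base-copy : ∀ u k w → C (base u) (copy k w) ≡ into u (e k)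
  C-base-copy u k w rewrite splitAt-↑ˡ n₁ u K | splitAt-↑ʳ n₁ K (combine {m} {n₂} k w) =
    cong (λ p → into u (e (proj₁ p))) (remQuot-combine {m} {n₂} k w)

  C-copy-base : ∀ k w v → C (copy k w) (base v) ≡ outof (e k) v
  C-copy-base k w v rewrite splitAt-↑ˡ n₁ v K | splitAt-↑ʳ n₁ K (combine {m} {n₂} k w) =
    cong (λ p → outof (e (proj₁ p)) v) (remQuot-combine {m} {n₂} k w)

  C-copy-copy : ∀ k w k′ w′ → C (copy k w) (copy k′ w′) ≡ ((k == k′) ∧ a₂ w w′)
  C-copy-copy k w k′ w′ rewrite splitAt-↑ʳ n₁ K (combine {m} {n₂} k w) | splitAt-↑ʳ n₁ K (combine {m} {n₂} k′ w′) =
    cong₂ (λ p q → (proj₁ p == proj₁ q) ∧ a₂ (proj₂ p) (proj₂ q)) (remQuot-combine {m} {n₂} k w) (remQuot-combine {m} {n₂} k′ w′)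

  ==-base : ∀ u v → (base u == base v) ≡ (u == v)
  ==-base = ==-injective base (↑ˡ-injective K _ _)

  ==-copy : ∀ k w k′ w′ → (copy k w == copy k′ w′) ≡ ((k == k′) ∧ (w == w′))
  ==-copy k w k′ w′ with k ≟ k′ | w ≟ w′
  ... | yes refl | yes refl = ==-refl (copy k w)
  ... | yes refl | no w≢w′ = ≢⇒==false (w≢w′ ∘ combine-injectiveʳ k w k w′ ∘ ↑ʳ-injective n₁ _ _)
  ... | no k≢k′ | _ = ≢⇒==false (k≢k′ ∘ combine-injectiveˡ k w k′ w′ ∘ ↑ʳ-injective n₁ _ _)

  base≢copy : ∀ u q → u ↑ˡ K ≢ n₁ ↑ʳ q
  base≢copy u q eq with trans (sym (splitAt-↑ˡ n₁ u K)) (trans (cong (splitAt n₁) eq) (splitAt-↑ʳ n₁ K q))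
  ... | ()

  intoCount : Fin n₁ → ℚ
  intoCount u = ∑ (λ k → ⟦ into u (e k) ⟧)

  out : Fin m → Fin n₁ → ℚ
  out k v = ⟦ outof (e k) v ⟧

  through : Mat n₁
  through u v = ∑ (λ k → ⟦ into u (e k) ⟧ * out k v)

  outdeg-base : ∀ u → outdeg C (base u) ≡ outdeg a₁ u + fromℕ n₂ * intoCount u
  outdeg-base u = begin
    ∑ (λ j → ⟦ C (base u) j ⟧) ≡⟨ ∑-↑ n₁ _ ⟩
    ∑ (λ v → ⟦ C (base u) (base v) ⟧) + ∑ (λ q → ⟦ C (base u) (n₁ ↑ʳ q) ⟧)
      ≡⟨ cong₂ _+_ (∑-cong (λ v → cong ⟦_⟧ (C-base-base u v))) (∑-combine m _) ⟩
    outdeg a₁ u + ∑ (λ k → ∑ (λ w → ⟦ C (base u) (copy k w) ⟧))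
      ≡⟨ cong (outdeg a₁ u +_) (∑-cong (λ k → trans (∑-cong (λ w → cong ⟦_⟧ (C-base-copy u k w))) (∑-const n₂ _))) ⟩
    outdeg a₁ u + ∑ (λ k → fromℕ n₂ * ⟦ into u (e k) ⟧)
      ≡⟨ cong (outdeg a₁ u +_) (∑-*ˡ (fromℕ n₂) (λ k → ⟦ into u (e k) ⟧)) ⟩
    outdeg a₁ u + fromℕ n₂ * intoCount u ∎

  outdeg-copy : ∀ δ → (∀ k → ∑ (out k) ≡ δ) → ∀ k w → outdeg C (copy k w) ≡ δ + outdeg a₂ w
  outdeg-copy δ out-δ k w = begin
    ∑ (λ j → ⟦ C (copy k w) j ⟧) ≡⟨ ∑-↑ n₁ _ ⟩
    ∑ (λ v → ⟦ C (copy k w) (base v) ⟧) + ∑ (λ q → ⟦ C (copy k w) (n₁ ↑ʳ q) ⟧)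
      ≡⟨ cong₂ _+_ (trans (∑-cong (λ v → cong ⟦_⟧ (C-copy-base k w v))) (out-δ k)) (∑-combine m _) ⟩
    δ + ∑ (λ k′ → ∑ (λ w′ → ⟦ C (copy k w) (copy k′ w′) ⟧))
      ≡⟨ cong (δ +_) (∑-cong (λ k′ → trans (∑-cong (λ w′ → trans (cong ⟦_⟧ (C-copy-copy k w k′ w′)) (⟦∧⟧ (k == k′) (a₂ w w′))))
                                          (∑-*ˡ ⟦ k == k′ ⟧ (λ w′ → ⟦ a₂ w w′ ⟧)))) ⟩
    δ + ∑ (λ k′ → ⟦ k == k′ ⟧ * outdeg a₂ w) ≡⟨ cong (δ +_) (∑-δ k (λ _ → outdeg a₂ w)) ⟩
    δ + outdeg a₂ w ∎

  -- colOps adds −γ · out k v times each column of copy k to base column v; this clears the copy rows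
  -- of the base columns because each row of M₂ sums to x − δ = 1/γ.
  module Reduction (x δ : ℚ) (out-δ : ∀ k → ∑ (out k) ≡ δ) .{{_ : NonZero (x - δ)}} where

    N : Mat (n₁ ℕ.+ K)
    N = charMat C x

    γ = 1/ (x - δ)

    M₂ : Mat n₂
    M₂ = charMat a₂ (x - δ)

    schur : Mat n₁
    schur = ((x · I) ⊖ (Lap a₁ ⊕ (fromℕ n₂ · diag intoCount))) ⊖ ((fromℕ n₂ * γ) · through)

    N-copy-copy : ∀ k w k′ w′ → N (copy k w) (copy k′ w′) ≡ ⟦ k == k′ ⟧ * M₂ w w′
    N-copy-copy k w k′ w′ = begin
      N (copy k w) (copy k′ w′)
        ≡⟨ charMat-entry C x (copy k w) (copy k′ w′) ⟩
      x * ⟦ copy k w == copy k′ w′ ⟧ - (⟦ copy k w == copy k′ w′ ⟧ * outdeg C (copy k w) - ⟦ C (copy k w) (copy k′ w′) ⟧)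
        ≡⟨ cong₃ (λ b d c → x * ⟦ b ⟧ - (⟦ b ⟧ * d - ⟦ c ⟧)) (==-copy k w k′ w′) (outdeg-copy δ out-δ k w) (C-copy-copy k w k′ w′) ⟩
      x * ⟦ (k == k′) ∧ (w == w′) ⟧ - (⟦ (k == k′) ∧ (w == w′) ⟧ * (δ + outdeg a₂ w) - ⟦ (k == k′) ∧ a₂ w w′ ⟧)
        ≡⟨ cong₂ (λ p q → x * p - (p * (δ + outdeg a₂ w) - q)) (⟦∧⟧ (k == k′) (w == w′)) (⟦∧⟧ (k == k′) (a₂ w w′)) ⟩
      x * (κ * ε) - ((κ * ε) * (δ + outdeg a₂ w) - κ * ⟦ a₂ w w′ ⟧)
        ≡⟨ solve 6 (λ x δ p q d a → x :* (p :* q) :- ((p :* q) :* (δ :+ d) :- p :* a) := p :* ((x :- δ) :* q :- (q :* d :- a)))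
                 refl x δ κ ε (outdeg a₂ w) ⟦ a₂ w w′ ⟧ ⟩
      κ * ((x - δ) * ε - (ε * outdeg a₂ w - ⟦ a₂ w w′ ⟧)) ≡⟨ cong (κ *_) (sym (charMat-entry a₂ (x - δ) w w′)) ⟩
      κ * M₂ w w′ ∎
      where
      κ = ⟦ k == k′ ⟧
      ε = ⟦ w == w′ ⟧

    isBase : Fin (n₁ ℕ.+ K) → Bool
    isBase c with splitAt n₁ c
    ... | inj₁ _ = true
    ... | inj₂ _ = false

    colOps : Fin (n₁ ℕ.+ K) → Fin (n₁ ℕ.+ K) → ℚ
    colOps l c with splitAt n₁ l | splitAt n₁ c
    ... | inj₂ p | inj₁ v = - (γ * out (proj₁ (remQuot {m} n₂ p)) v)
    ... | _      | _      = 0ℚ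

    colOps-into-copy : ∀ l c → isBase c ≡ false → colOps l c ≡ 0ℚ
    colOps-into-copy l c c∉base with splitAt n₁ l | splitAt n₁ c
    ... | inj₁ _ | _      = refl
    ... | inj₂ _ | inj₂ _ = refl
    colOps-into-copy l c () | inj₂ _ | inj₁ _

    colOps-from-base : ∀ l c → isBase l ≡ true → colOps l c ≡ 0ℚ
    colOps-from-base l c l∈base with splitAt n₁ l
    ... | inj₁ _ = refl
    colOps-from-base l c () | inj₂ _

    colOps-copy-base : ∀ k w v → colOps (copy k w) (base v) ≡ - (γ * out k v)
    colOps-copy-base k w v rewrite splitAt-↑ʳ n₁ K (combine {m} {n₂} k w) | splitAt-↑ˡ n₁ v K =
      cong (λ p → - (γ * out (proj₁ p) v)) (remQuot-combine {m} {n₂} k w)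

    colOps-base : ∀ u c → colOps (base u) c ≡ 0ℚ
    colOps-base u c rewrite splitAt-↑ˡ n₁ u K = refl

    isBase-copy : ∀ q → isBase (n₁ ↑ʳ q) ≡ false
    isBase-copy q rewrite splitAt-↑ʳ n₁ K q = refl

    reduced : Mat (n₁ ℕ.+ K)
    reduced = addCols N colOps

    ∑-colOps : ∀ i v → ∑ (λ l → N i l * colOps l (base v)) ≡ ∑ (λ k → ∑ (λ w → N i (copy k w) * - (γ * out k v)))
    ∑-colOps i v = begin
      ∑ (λ l → N i l * colOps l (base v)) ≡⟨ ∑-↑ n₁ _ ⟩
      ∑ (λ u → N i (base u) * colOps (base u) (base v)) + ∑ (λ q → N i (n₁ ↑ʳ q) * colOps (n₁ ↑ʳ q) (base v))
        ≡⟨ cong₂ _+_ (∑-zero _ (λ u → trans (cong (N i (base u) *_) (colOps-base u (base v))) (*-zeroʳ (N i (base u)))))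
                     (∑-combine m _) ⟩
      0ℚ + ∑ (λ k → ∑ (λ w → N i (copy k w) * colOps (copy k w) (base v))) ≡⟨ +-identityˡ _ ⟩
      ∑ (λ k → ∑ (λ w → N i (copy k w) * colOps (copy k w) (base v)))
        ≡⟨ ∑-cong (λ k → ∑-cong (λ w → cong (N i (copy k w) *_) (colOps-copy-base k w v))) ⟩
      ∑ (λ k → ∑ (λ w → N i (copy k w) * - (γ * out k v))) ∎

    reduced-copy-base : ∀ k w v → reduced (copy k w) (base v) ≡ 0ℚ
    reduced-copy-base k w v = begin
      N (copy k w) (base v) + ∑ (λ l → N (copy k w) l * colOps l (base v))
        ≡⟨ cong₂ _+_ (trans (charMat-off-diagonal C x _ _ (≢⇒==false (base≢copy v _ ∘ sym))) (cong ⟦_⟧ (C-copy-base k w v)))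
                     (∑-colOps (copy k w) v) ⟩
      out k v + ∑ (λ k′ → ∑ (λ w′ → N (copy k w) (copy k′ w′) * - (γ * out k′ v)))
        ≡⟨ cong (out k v +_) (∑-cong copy-sum) ⟩
      out k v + ∑ (λ k′ → ⟦ k == k′ ⟧ * (- (γ * out k′ v) * (x - δ)))
        ≡⟨ cong (out k v +_) (∑-δ k (λ k′ → - (γ * out k′ v) * (x - δ))) ⟩
      out k v + - (γ * out k v) * (x - δ)
        ≡⟨ solve 3 (λ o g y → o :+ (:- (g :* o)) :* y := o :* (con 1ℚ :- g :* y)) refl (out k v) γ (x - δ) ⟩
      out k v * (1ℚ - γ * (x - δ)) ≡⟨ cong (λ z → out k v * (1ℚ - z)) (*-inverseˡ (x - δ)) ⟩
      out k v * (1ℚ - 1ℚ)          ≡⟨ *-zeroʳ (out k v) ⟩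
      0ℚ ∎
      where
      copy-sum : ∀ k′ → ∑ (λ w′ → N (copy k w) (copy k′ w′) * - (γ * out k′ v)) ≡ ⟦ k == k′ ⟧ * (- (γ * out k′ v) * (x - δ))
      copy-sum k′ = begin
        ∑ (λ w′ → N (copy k w) (copy k′ w′) * c)
          ≡⟨ ∑-cong (λ w′ → trans (cong (_* c) (N-copy-copy k w k′ w′))
                                  (solve 3 (λ p q c → (p :* q) :* c := (p :* c) :* q) refl ⟦ k == k′ ⟧ (M₂ w w′) c)) ⟩
        ∑ (λ w′ → (⟦ k == k′ ⟧ * c) * M₂ w w′) ≡⟨ ∑-*ˡ (⟦ k == k′ ⟧ * c) (M₂ w) ⟩
        (⟦ k == k′ ⟧ * c) * ∑ (M₂ w)           ≡⟨ cong ((⟦ k == k′ ⟧ * c) *_) (charMat-row-sum a₂ (x - δ) w) ⟩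
        (⟦ k == k′ ⟧ * c) * (x - δ)            ≡⟨ *-assoc ⟦ k == k′ ⟧ c (x - δ) ⟩
        ⟦ k == k′ ⟧ * (c * (x - δ)) ∎
        where c = - (γ * out k′ v)

    reduced-base-base : ∀ u v → reduced (base u) (base v) ≡ schur u v
    reduced-base-base u v = begin
      N (base u) (base v) + ∑ (λ l → N (base u) l * colOps l (base v))
        ≡⟨ cong₂ _+_ base-entry
             (trans (∑-colOps (base u) v) (∑-cong λ k → ∑-cong λ w →
               cong (_* - (γ * out k v)) (trans (charMat-off-diagonal C x _ _ (≢⇒==false (base≢copy u _)))
                                                (cong ⟦_⟧ (C-base-copy u k w))))) ⟩
      (x * ι - (ι * (outdeg a₁ u + fromℕ n₂ * intoCount u) - ⟦ a₁ u v ⟧))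
        + ∑ (λ k → ∑ {n₂} (λ w → ⟦ into u (e k) ⟧ * - (γ * out k v)))
        ≡⟨ cong (x * ι - (ι * (outdeg a₁ u + fromℕ n₂ * intoCount u) - ⟦ a₁ u v ⟧) +_) through-sum ⟩
      (x * ι - (ι * (outdeg a₁ u + fromℕ n₂ * intoCount u) - ⟦ a₁ u v ⟧)) + - (fromℕ n₂ * γ) * through u v
        ≡⟨ solve 8 (λ x i d n c a g r → (x :* i :- (i :* (d :+ n :* c) :- a)) :+ (:- (n :* g)) :* r
                                        := (x :* i :- ((i :* d :- a) :+ n :* (i :* c))) :- (n :* g) :* r)
                 refl x ι (outdeg a₁ u) (fromℕ n₂) (intoCount u) ⟦ a₁ u v ⟧ γ (through u v) ⟩
      (x * ι - ((ι * outdeg a₁ u - ⟦ a₁ u v ⟧) + fromℕ n₂ * (ι * intoCount u))) - (fromℕ n₂ * γ) * through u v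
        ≡⟨ sym (cong₃ (λ p q r → (x * p - ((q - ⟦ a₁ u v ⟧) + fromℕ n₂ * r)) - (fromℕ n₂ * γ) * through u v)
                      (I-⟦==⟧ u v) (diag-⟦==⟧ (outdeg a₁) u v) (diag-⟦==⟧ intoCount u v)) ⟩
      schur u v ∎
      where
      ι = ⟦ u == v ⟧
      base-entry : N (base u) (base v) ≡ x * ι - (ι * (outdeg a₁ u + fromℕ n₂ * intoCount u) - ⟦ a₁ u v ⟧)
      base-entry = trans (charMat-entry C x _ _)
                         (cong₃ (λ b d c → x * ⟦ b ⟧ - (⟦ b ⟧ * d - ⟦ c ⟧)) (==-base u v) (outdeg-base u) (C-base-base u v))
      through-sum : ∑ (λ k → ∑ {n₂} (λ w → ⟦ into u (e k) ⟧ * - (γ * out k v))) ≡ - (fromℕ n₂ * γ) * through u v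
      through-sum = begin
        ∑ (λ k → ∑ {n₂} (λ w → ⟦ into u (e k) ⟧ * - (γ * out k v)))
          ≡⟨ ∑-cong (λ k → trans (∑-const n₂ _)
               (solve 4 (λ n i g o → n :* (i :* (:- (g :* o))) := (:- (n :* g)) :* (i :* o)) refl (fromℕ n₂) ⟦ into u (e k) ⟧ γ (out k v))) ⟩
        ∑ (λ k → - (fromℕ n₂ * γ) * (⟦ into u (e k) ⟧ * out k v)) ≡⟨ ∑-*ˡ (- (fromℕ n₂ * γ)) (λ k → ⟦ into u (e k) ⟧ * out k v) ⟩
        - (fromℕ n₂ * γ) * through u v ∎

    reduced-copy-copy : ∀ k k′ w w′ → reduced (copy k w) (copy k′ w′) ≡ ⟦ k == k′ ⟧ * M₂ w w′
    reduced-copy-copy k k′ w w′ = trans (addCols-unchanged N colOps _ (λ l → colOps-into-copy l _ (isBase-copy _)) (copy k w))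
                                        (N-copy-copy k w k′ w′)

    reduced-lower-zero : ∀ (i : Fin K) (j : Fin n₁) → reduced (n₁ ↑ʳ i) (base j) ≡ 0ℚ
    reduced-lower-zero i j = trans (cong (λ z → reduced (n₁ ↑ʳ z) (base j)) (sym (combine-remQuot {m} n₂ i)))
                                   (reduced-copy-base _ _ j)

    charPoly-corona : charPoly (Lap C) x ≡ (charPoly (Lap a₂) (x - δ) ^ m) * det schur
    charPoly-corona = begin
      det N ≡⟨ sym (det-add-cols N colOps isBase colOps-into-copy colOps-from-base) ⟩
      det reduced ≡⟨ det-block-upper-triangular n₁ reduced reduced-lower-zero ⟩
      det (λ i j → reduced (base i) (base j)) * det (λ i j → reduced (n₁ ↑ʳ i) (n₁ ↑ʳ j))
        ≡⟨ cong₂ _*_ (det-cong reduced-base-base) (det-block-diagonal m _ M₂ reduced-copy-copy) ⟩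
      det schur * (det M₂ ^ m) ≡⟨ *-comm (det schur) (det M₂ ^ m) ⟩
      (det M₂ ^ m) * det schur ∎

schur-cong : ∀ {n} (x c c′ : ℚ) (L : Mat n) {d d′ : Fin n → ℚ} {R R′ : Mat n} →
  (∀ u → d u ≡ d′ u) → (∀ u v → R u v ≡ R′ u v) →
  det (((x · I) ⊖ (L ⊕ (c · diag d))) ⊖ (c′ · R)) ≡ det (((x · I) ⊖ (L ⊕ (c · diag d′))) ⊖ (c′ · R′))
schur-cong x c c′ L d≗d′ R≗R′ = det-cong (λ u v →
  cong₂ (λ p q → (x * I u v - (L u v + c * p)) - c′ * q) (cong (λ z → if u == v then z else 0ℚ) (d≗d′ u)) (R≗R′ u v))

module Forward {n₁ n₂} (D₁ : Digraph n₁) (D₂ : Digraph n₂) where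
  private
    a = adj D₁
    isArc = λ (p : Fin n₁ × Fin n₁) → a (proj₁ p) (proj₂ p)
  open ArcCorona a (adj D₂) (arcs a) (λ u e → u == proj₁ e) (λ e v → v == proj₂ e)

  intoCount≡outdeg : ∀ u → intoCount u ≡ outdeg a u
  intoCount≡outdeg u = trans (∑-filtered-pairs isArc (λ p → ⟦ u == proj₁ p ⟧)) (∑∑-δ u (λ i j → ⟦ a i j ⟧))

  through≡A : ∀ u v → through u v ≡ AMat a u v
  through≡A u v = begin
    through u v                                                  ≡⟨ ∑-filtered-pairs isArc (λ p → ⟦ u == proj₁ p ⟧ * ⟦ v == proj₂ p ⟧) ⟩
    ∑ (λ i → ∑ (λ j → ⟦ a i j ⟧ * (⟦ u == i ⟧ * ⟦ v == j ⟧)))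
      ≡⟨ ∑-cong (λ i → ∑-cong (λ j → solve 3 (λ A U V → A :* (U :* V) := (A :* V) :* U) refl ⟦ a i j ⟧ ⟦ u == i ⟧ ⟦ v == j ⟧)) ⟩
    ∑ (λ i → ∑ (λ j → (⟦ a i j ⟧ * ⟦ v == j ⟧) * ⟦ u == i ⟧)) ≡⟨ ∑∑-δ u (λ i j → ⟦ a i j ⟧ * ⟦ v == j ⟧) ⟩
    ∑ (λ j → ⟦ a u j ⟧ * ⟦ v == j ⟧)                           ≡⟨ ∑-δʳ v (λ j → ⟦ a u j ⟧) ⟩
    AMat a u v ∎

  charPoly-fwdCorona : ∀ (x : ℚ) .{{_ : NonZero (x - 1ℚ)}} →
    charPoly (Lap (fwdCorona D₁ D₂)) x
      ≡ (charPoly (Lap (adj D₂)) (x - 1ℚ) ^ length (arcs a))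
        * det (((x · I) ⊖ (Lap a ⊕ (fromℕ n₂ · Dout a))) ⊖ ((fromℕ n₂ * (1/ (x - 1ℚ))) · AMat a))
  charPoly-fwdCorona x = trans (charPoly-corona)
    (cong (charPoly (Lap (adj D₂)) (x - 1ℚ) ^ m *_) (schur-cong x (fromℕ n₂) (fromℕ n₂ * (1/ (x - 1ℚ))) (Lap a) intoCount≡outdeg through≡A))
    where open Reduction x 1ℚ (λ k → ∑-⟦==⟧ (proj₂ (e k)))

module Backward {n₁ n₂} (D₁ : Digraph n₁) (D₂ : Digraph n₂) where
  private
    a = adj D₁
    isArc = λ (p : Fin n₁ × Fin n₁) → a (proj₁ p) (proj₂ p)
  open ArcCorona a (adj D₂) (arcs a) (λ v e → v == proj₂ e) (λ e u → u == proj₁ e)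

  intoCount≡indeg : ∀ u → intoCount u ≡ indeg a u
  intoCount≡indeg u = trans (∑-filtered-pairs isArc (λ p → ⟦ u == proj₂ p ⟧)) (∑-cong (λ i → ∑-δʳ u (λ j → ⟦ a i j ⟧)))

  through≡Aᵀ : ∀ u v → through u v ≡ (AMat a ᵀ) u v
  through≡Aᵀ u v = begin
    through u v                                                  ≡⟨ ∑-filtered-pairs isArc (λ p → ⟦ u == proj₂ p ⟧ * ⟦ v == proj₁ p ⟧) ⟩
    ∑ (λ i → ∑ (λ j → ⟦ a i j ⟧ * (⟦ u == j ⟧ * ⟦ v == i ⟧)))
      ≡⟨ ∑-cong (λ i → ∑-cong (λ j → solve 3 (λ A U V → A :* (U :* V) := (A :* U) :* V) refl ⟦ a i j ⟧ ⟦ u == j ⟧ ⟦ v == i ⟧)) ⟩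
    ∑ (λ i → ∑ (λ j → (⟦ a i j ⟧ * ⟦ u == j ⟧) * ⟦ v == i ⟧)) ≡⟨ ∑∑-δ v (λ i j → ⟦ a i j ⟧ * ⟦ u == j ⟧) ⟩
    ∑ (λ j → ⟦ a v j ⟧ * ⟦ u == j ⟧)                           ≡⟨ ∑-δʳ u (λ j → ⟦ a v j ⟧) ⟩
    (AMat a ᵀ) u v ∎

  charPoly-bwdCorona : ∀ (x : ℚ) .{{_ : NonZero (x - 1ℚ)}} →
    charPoly (Lap (bwdCorona D₁ D₂)) x
      ≡ (charPoly (Lap (adj D₂)) (x - 1ℚ) ^ length (arcs a))
        * det (((x · I) ⊖ (Lap a ⊕ (fromℕ n₂ · Din a))) ⊖ ((fromℕ n₂ * (1/ (x - 1ℚ))) · (AMat a ᵀ)))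
  charPoly-bwdCorona x = trans (charPoly-corona)
    (cong (charPoly (Lap (adj D₂)) (x - 1ℚ) ^ m *_) (schur-cong x (fromℕ n₂) (fromℕ n₂ * (1/ (x - 1ℚ))) (Lap a) intoCount≡indeg through≡Aᵀ))
    where open Reduction x 1ℚ (λ k → ∑-⟦==⟧ (proj₁ (e k)))

module Symmetric {n₁ n₂} (D₁ : Digraph n₁) (D₂ : Digraph n₂) where
  private
    a = adj D₁
    G = U a
    isEdge = λ (p : Fin n₁ × Fin n₁) → ⌊ toℕ (proj₁ p) ℕ.<? toℕ (proj₂ p) ⌋ ∧ G (proj₁ p) (proj₂ p)
  open ArcCorona a (adj D₂) (edges a) (λ u e → (u == proj₁ e) ∨ (u == proj₂ e)) (λ e v → (v == proj₁ e) ∨ (v == proj₂ e))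

  P : Fin n₁ → Fin n₁ → ℚ
  P i j = ⟦ isEdge (i , j) ⟧

  edge-endpoints-distinct : ∀ k → proj₁ (e k) ≢ proj₂ (e k)
  edge-endpoints-distinct k with toℕ (proj₁ (e k)) ℕ.<? toℕ (proj₂ (e k)) | lookup-filterᵇ isEdge (cartesianProduct (allFin n₁) (allFin n₁)) k
  ... | yes i<j | _ = FinP.<⇒≢ i<j
  ... | no _ | ()

  P-orientations : ∀ u j → P u j + P j u ≡ ⟦ G u j ⟧
  P-orientations u j with toℕ u ℕ.<? toℕ j | toℕ j ℕ.<? toℕ u
  ... | yes u<j | yes j<u = ⊥-elim (ℕP.<-asym u<j j<u)
  ... | yes _ | no _ = +-identityʳ _
  ... | no _ | yes _ = trans (+-identityˡ _) (cong ⟦_⟧ (∨-comm (a j u) (a u j)))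
  ... | no u≮j | no j≮u rewrite toℕ-injective {i = u} {j} (ℕP.≤-antisym (ℕP.≮⇒≥ j≮u) (ℕP.≮⇒≥ u≮j)) | irrefl D₁ j =
    +-identityʳ 0ℚ

  P-split : ∀ u i j → P i j * ⟦ (u == i) ∨ (u == j) ⟧ ≡ P i j * ⟦ u == i ⟧ + P i j * ⟦ u == j ⟧
  P-split u i j with toℕ i ℕ.<? toℕ j
  ... | yes i<j = trans (cong (⟦ G i j ⟧ *_) (⟦==∨==⟧ (FinP.<⇒≢ i<j) u)) (*-distribˡ-+ ⟦ G i j ⟧ _ _)
  ... | no _ = solve 3 (λ p q r → con 0ℚ :* p := con 0ℚ :* q :+ con 0ℚ :* r) refl
                 ⟦ (u == i) ∨ (u == j) ⟧ ⟦ u == i ⟧ ⟦ u == j ⟧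

  ∑∑-P-endpoints : ∀ u → ∑ (λ i → ∑ (λ j → P i j * ⟦ u == i ⟧ + P i j * ⟦ u == j ⟧)) ≡ outdeg G u
  ∑∑-P-endpoints u = begin
    ∑ (λ i → ∑ (λ j → P i j * ⟦ u == i ⟧ + P i j * ⟦ u == j ⟧))
      ≡⟨ ∑∑-+ (λ i j → P i j * ⟦ u == i ⟧) (λ i j → P i j * ⟦ u == j ⟧) ⟩
    ∑ (λ i → ∑ (λ j → P i j * ⟦ u == i ⟧)) + ∑ (λ i → ∑ (λ j → P i j * ⟦ u == j ⟧))
      ≡⟨ cong₂ _+_ (∑∑-δ u P) (∑-cong (λ i → ∑-δʳ u (P i))) ⟩
    ∑ (P u) + ∑ (λ j → P j u) ≡⟨ sym (∑-+ (P u) (λ j → P j u)) ⟩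
    ∑ (λ j → P u j + P j u)   ≡⟨ ∑-cong (P-orientations u) ⟩
    outdeg G u ∎

  intoCount≡degree : ∀ u → intoCount u ≡ outdeg G u
  intoCount≡degree u = begin
    intoCount u ≡⟨ ∑-filtered-pairs isEdge (λ p → ⟦ (u == proj₁ p) ∨ (u == proj₂ p) ⟧) ⟩
    ∑ (λ i → ∑ (λ j → P i j * ⟦ (u == i) ∨ (u == j) ⟧))                     ≡⟨ ∑-cong (λ i → ∑-cong (P-split u i)) ⟩
    ∑ (λ i → ∑ (λ j → P i j * ⟦ u == i ⟧ + P i j * ⟦ u == j ⟧))             ≡⟨ ∑∑-P-endpoints u ⟩
    outdeg G u ∎

  P-product : ∀ u v i j → P i j * (⟦ (u == i) ∨ (u == j) ⟧ * ⟦ (v == i) ∨ (v == j) ⟧)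
    ≡ ⟦ u == v ⟧ * (P i j * ⟦ u == i ⟧ + P i j * ⟦ u == j ⟧)
      + ((P i j * ⟦ v == j ⟧) * ⟦ u == i ⟧ + (P i j * ⟦ u == j ⟧) * ⟦ v == i ⟧)
  P-product u v i j with toℕ i ℕ.<? toℕ j
  ... | yes i<j = begin
    p * (⟦ (u == i) ∨ (u == j) ⟧ * ⟦ (v == i) ∨ (v == j) ⟧)
      ≡⟨ cong₂ (λ A B → p * (A * B)) (⟦==∨==⟧ i≢j u) (⟦==∨==⟧ i≢j v) ⟩
    p * ((ui + uj) * (vi + vj))
      ≡⟨ solve 5 (λ p ui uj vi vj → p :* ((ui :+ uj) :* (vi :+ vj))
                    := p :* (ui :* vi) :+ p :* (uj :* vj) :+ ((p :* vj) :* ui :+ (p :* uj) :* vi)) refl p ui uj vi vj ⟩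
    p * (ui * vi) + p * (uj * vj) + ((p * vj) * ui + (p * uj) * vi)
      ≡⟨ cong₂ (λ A B → p * A + p * B + ((p * vj) * ui + (p * uj) * vi)) (⟦==⟧*⟦==⟧ u v i) (⟦==⟧*⟦==⟧ u v j) ⟩
    p * (w * ui) + p * (w * uj) + ((p * vj) * ui + (p * uj) * vi)
      ≡⟨ solve 6 (λ p ui uj vi vj w → p :* (w :* ui) :+ p :* (w :* uj) :+ ((p :* vj) :* ui :+ (p :* uj) :* vi)
                    := w :* (p :* ui :+ p :* uj) :+ ((p :* vj) :* ui :+ (p :* uj) :* vi)) refl p ui uj vi vj w ⟩
    w * (p * ui + p * uj) + ((p * vj) * ui + (p * uj) * vi) ∎
    where
    i≢j = FinP.<⇒≢ i<j
    p = ⟦ G i j ⟧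
    ui = ⟦ u == i ⟧
    uj = ⟦ u == j ⟧
    vi = ⟦ v == i ⟧
    vj = ⟦ v == j ⟧
    w = ⟦ u == v ⟧
  ... | no _ = solve 7 (λ X w a b c d e → con 0ℚ :* X := w :* (con 0ℚ :* a :+ con 0ℚ :* b) :+ ((con 0ℚ :* c) :* d :+ (con 0ℚ :* b) :* e))
                 refl (⟦ (u == i) ∨ (u == j) ⟧ * ⟦ (v == i) ∨ (v == j) ⟧) ⟦ u == v ⟧ ⟦ u == i ⟧ ⟦ u == j ⟧ ⟦ v == j ⟧ ⟦ u == i ⟧ ⟦ v == i ⟧

  through≡Q : ∀ u v → through u v ≡ Q G u v
  through≡Q u v = begin
    through u v
      ≡⟨ ∑-filtered-pairs isEdge (λ p → ⟦ (u == proj₁ p) ∨ (u == proj₂ p) ⟧ * ⟦ (v == proj₁ p) ∨ (v == proj₂ p) ⟧) ⟩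
    ∑ (λ i → ∑ (λ j → P i j * (⟦ (u == i) ∨ (u == j) ⟧ * ⟦ (v == i) ∨ (v == j) ⟧)))
      ≡⟨ ∑-cong (λ i → ∑-cong (P-product u v i)) ⟩
    ∑ (λ i → ∑ (λ j → diagonal i j + cross i j))
      ≡⟨ ∑∑-+ diagonal cross ⟩
    ∑ (λ i → ∑ (diagonal i)) + ∑ (λ i → ∑ (cross i))
      ≡⟨ cong₂ _+_ diagonal-sum cross-sum ⟩
    ⟦ u == v ⟧ * outdeg G u + (P u v + P v u)
      ≡⟨ cong₂ _+_ (sym (diag-⟦==⟧ (outdeg G) u v)) (P-orientations u v) ⟩
    Q G u v ∎
    where
    diagonal cross : Fin n₁ → Fin n₁ → ℚ
    diagonal i j = ⟦ u == v ⟧ * (P i j * ⟦ u == i ⟧ + P i j * ⟦ u == j ⟧)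
    cross i j = (P i j * ⟦ v == j ⟧) * ⟦ u == i ⟧ + (P i j * ⟦ u == j ⟧) * ⟦ v == i ⟧
    diagonal-sum : ∑ (λ i → ∑ (diagonal i)) ≡ ⟦ u == v ⟧ * outdeg G u
    diagonal-sum = begin
      ∑ (λ i → ∑ (diagonal i))
        ≡⟨ ∑-cong (λ i → ∑-*ˡ ⟦ u == v ⟧ (λ j → P i j * ⟦ u == i ⟧ + P i j * ⟦ u == j ⟧)) ⟩
      ∑ (λ i → ⟦ u == v ⟧ * ∑ (λ j → P i j * ⟦ u == i ⟧ + P i j * ⟦ u == j ⟧))
        ≡⟨ ∑-*ˡ ⟦ u == v ⟧ (λ i → ∑ (λ j → P i j * ⟦ u == i ⟧ + P i j * ⟦ u == j ⟧)) ⟩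
      ⟦ u == v ⟧ * ∑ (λ i → ∑ (λ j → P i j * ⟦ u == i ⟧ + P i j * ⟦ u == j ⟧))
        ≡⟨ cong (⟦ u == v ⟧ *_) (∑∑-P-endpoints u) ⟩
      ⟦ u == v ⟧ * outdeg G u ∎
    cross-sum : ∑ (λ i → ∑ (cross i)) ≡ P u v + P v u
    cross-sum = trans (∑∑-+ (λ i j → (P i j * ⟦ v == j ⟧) * ⟦ u == i ⟧) (λ i j → (P i j * ⟦ u == j ⟧) * ⟦ v == i ⟧))
                      (cong₂ _+_ (trans (∑∑-δ u (λ i j → P i j * ⟦ v == j ⟧)) (∑-δʳ v (P u)))
                                 (trans (∑∑-δ v (λ i j → P i j * ⟦ u == j ⟧)) (∑-δʳ u (P v))))

  copy-attachments : ∀ k → ∑ (out k) ≡ fromℕ 2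
  copy-attachments k = begin
    ∑ (out k)                                               ≡⟨ ∑-cong (⟦==∨==⟧ (edge-endpoints-distinct k)) ⟩
    ∑ (λ v → ⟦ v == proj₁ (e k) ⟧ + ⟦ v == proj₂ (e k) ⟧) ≡⟨ ∑-+ (λ v → ⟦ v == proj₁ (e k) ⟧) (λ v → ⟦ v == proj₂ (e k) ⟧) ⟩
    ∑ (λ v → ⟦ v == proj₁ (e k) ⟧) + ∑ (λ v → ⟦ v == proj₂ (e k) ⟧)
      ≡⟨ cong₂ _+_ (∑-⟦==⟧ (proj₁ (e k))) (∑-⟦==⟧ (proj₂ (e k))) ⟩
    fromℕ 2 ∎

  charPoly-symCorona : ∀ (x : ℚ) .{{_ : NonZero (x - fromℕ 2)}} →
    charPoly (Lap (symCorona D₁ D₂)) x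
      ≡ (charPoly (Lap (adj D₂)) (x - fromℕ 2) ^ length (edges a))
        * det (((x · I) ⊖ (Lap a ⊕ (fromℕ n₂ · Ddeg G))) ⊖ ((fromℕ n₂ * (1/ (x - fromℕ 2))) · Q G))
  charPoly-symCorona x = trans (charPoly-corona)
    (cong (charPoly (Lap (adj D₂)) (x - fromℕ 2) ^ m *_)
          (schur-cong x (fromℕ n₂) (fromℕ n₂ * (1/ (x - fromℕ 2))) (Lap a) intoCount≡degree through≡Q))
    where open Reduction x (fromℕ 2) copy-attachments

theorem4p8 : ∀ {n₁ n₂} (D₁ : Digraph n₁) (D₂ : Digraph n₂) →
  let A₁ = adj D₁
      A₂ = adj D₂
      m₁ = length (arcs A₁)
      m₁′ = length (edges A₁)
      G₁ = U A₁
  in (∀ (x : ℚ) .{{_ : NonZero (x - 1ℚ)}} →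
        charPoly (Lap (fwdCorona D₁ D₂)) x
          ≡ (charPoly (Lap A₂) (x - 1ℚ) ^ m₁)
            * det (((x · I) ⊖ (Lap A₁ ⊕ (fromℕ n₂ · Dout A₁)))
                   ⊖ ((fromℕ n₂ * (1/ (x - 1ℚ))) · AMat A₁)))
   × (∀ (x : ℚ) .{{_ : NonZero (x - 1ℚ)}} →
        charPoly (Lap (bwdCorona D₁ D₂)) x
          ≡ (charPoly (Lap A₂) (x - 1ℚ) ^ m₁)
            * det (((x · I) ⊖ (Lap A₁ ⊕ (fromℕ n₂ · Din A₁)))
                   ⊖ ((fromℕ n₂ * (1/ (x - 1ℚ))) · (AMat A₁ ᵀ))))
   × (∀ (x : ℚ) .{{_ : NonZero (x - fromℕ 2)}} →
        charPoly (Lap (symCorona D₁ D₂)) x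
          ≡ (charPoly (Lap A₂) (x - fromℕ 2) ^ m₁′)
            * det (((x · I) ⊖ (Lap A₁ ⊕ (fromℕ n₂ · Ddeg G₁)))
                   ⊖ ((fromℕ n₂ * (1/ (x - fromℕ 2))) · Q G₁)))
theorem4p8 D₁ D₂ =
  Forward.charPoly-fwdCorona D₁ D₂ , Backward.charPoly-bwdCorona D₁ D₂ , Symmetric.charPoly-symCorona D₁ D₂
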